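{- Let $q$ be a prime power, let $\mathbb{F}_q[x]$ be the ring of polynomials over the finite field $\mathbb{F}_q$ with $q$ elements, and let $R=\mathbb{F}_q[x]/K$ be the quotient ring of $\mathbb{F}_q[x]$ modulo any ideal $K$. Let $\mathcal{S}_R$ be the multiplicative semigroup of the ring $R$ and let ${\rm U}(\mathcal{S}_R)$ be its group of units. Then $${\rm I}(\mathcal{S}_R)\geq {\rm D}({\rm U}(\mathcal{S}_R))+\Omega(K)-\omega(K),$$ where ${\rm I}$ denotes the Erdős–Burgess constant, ${\rm D}$ denotes the Davenport constant, $\Omega(K)$ is the number of prime ideals (repetitions are counted) and $\omega(K)$ the number of distinct prime ideals in the factorization when $K$ is factored into a product of prime ideals. Moreover, the equality $${\rm I}(\mathcal{S}_R)= {\rm D}({\rm U}(\mathcal{S}_R))+\Omega(K)-\omega(K)$$ holds for the case when $K$ is factored into either a power of some prime ideal or a product of some pairwise distinct prime ideals in $\mathbb{F}_q[x]$.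
   Context: Sequences are finite, and repetition of terms is allowed. Erdős–Burgess constant: let $\mathcal{S}$ be a nonempty commutative semigroup, written multiplicatively. An element $e\in\mathcal{S}$ is idempotent if $e\cdot e=e$. A sequence $T$ of terms from $\mathcal{S}$ is idempotent-product free if no nonempty subsequence of $T$ has the product of its terms equal to an idempotent of $\mathcal{S}$ (a subsequence is a sub-multiset of the terms; the order is irrelevant since $\mathcal{S}$ is commutative; the empty sequence is idempotent-product free). The Erdős–Burgess constant ${\rm I}(\mathcal{S})$ is the least $\ell\in\mathbb{N}\cup\{\infty\}$ such that every sequence of terms from $\mathcal{S}$ of length at least $\ell$ is not idempotent-product free; equivalently, ${\rm I}(\mathcal{S})=\sup\{|T|+1 : T \text{ is an idempotent-product free sequence of terms from } \mathcal{S}\}$. Davenport constant: for a finite abelian group $G$, ${\rm D}(G)$ is the smallest positive integer $\ell$ such that every sequence of terms from $G$ of length at least $\ell$ contains a nonempty subsequence the product of whose terms (the sum, if $G$ is written additively) is the identity element of $G$. $\mathcal{S}_R$ is the set $R$ with the ring multiplication, and ${\rm U}(\mathcal{S}_R)$ is the group of invertible elements of $R$. A nonzero proper ideal $K$ factors as $K=P_1^{n_1}\cdots P_r^{n_r}$ with $P_1,\dots,P_r$ distinct prime ideals and all $n_i\geq 1$; then $\Omega(K)=\sum_{i=1}^r n_i$ and $\omega(K)=r$. For $K=\mathbb{F}_q[x]$, $R$ is the zero ring, ${\rm I}(\mathcal{S}_R)=1$ and $\Omega(K)=\omega(K)=0$. For the zero ideal $K$, $R=\mathbb{F}_q[x]$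 and ${\rm I}(\mathcal{S}_R)=\infty$ (any sequence of nonconstant polynomials is idempotent-product free); the authors count this case as covered, remarking that the conclusion holds trivially there, and give no separate values of $\Omega$ and $\omega$ for it. -}

module Defs where

open import Algebra.Bundles
  using (AbelianGroup; CommutativeMonoid; CommutativeRing; CommutativeSemigroup)
import Algebra.Definitions as Definitions
import Algebra.Properties.AbelianGroup as AbelianGroupProperties
import Algebra.Properties.CommutativeSemigroup as CommutativeSemigroupProperties
import Algebra.Properties.Ring as RingProperties
open import Data.Fin.Base using (Fin)
open import Data.List.Base using (List; []; _∷_; length; map)
open import Data.List.NonEmpty.Base using (List⁺; toList; foldr₁)
open import Data.List.Relation.Binary.Sublist.Propositional using (_⊆_)
open import Data.Nat.Base as ℕ using (ℕ; zero; suc)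
open import Data.Nat.Primality using (Prime)
open import Data.Product.Base using (Σ; ∃; ∃-syntax; _×_; _,_; proj₁; proj₂)
open import Data.Sum.Base using (_⊎_)
open import Data.Unit.Polymorphic.Base using (⊤; tt)
import Data.Vec.Functional as Vector
open import Function.Bundles using (Inverse)
open import Level using (Level; _⊔_) renaming (suc to lsuc)
open import Relation.Binary.Construct.Add.Supremum.NonStrict ℕ._≤_
  using (_≤⁺_)
open import Relation.Binary.PropositionalEquality.Core using (_≡_; _≢_)
import Relation.Binary.PropositionalEquality.Properties as ≡
import Relation.Binary.Reasoning.Setoid as SetoidReasoning
open import Relation.Nullary.Construct.Add.Supremum using (_⁺; [_])
open import Relation.Nullary.Negation.Core using (¬_)
open import Relation.Unary using (Pred; _∈_; _≐_)

-- ℕ ∪ {∞}; the point at infinity is ⊤⁺, the order is _≤⁺_.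
ℕ∞ : Set
ℕ∞ = ℕ ⁺

-- Sequences are lists.  Multiplication being commutative, the product of a
-- sub-multiset of terms is the product of the corresponding sublist, so
-- order-preserving sublists suffice as subsequences.
module _ {c ℓ : Level} (S : CommutativeSemigroup c ℓ) where
  open CommutativeSemigroup S
  open Definitions _≈_ using (_IdempotentOn_)

  IdempotentProductFree : List Carrier → Set (c ⊔ ℓ)
  IdempotentProductFree T =
    (T′ : List⁺ Carrier) → toList T′ ⊆ T → ¬ (_∙_ IdempotentOn foldr₁ _∙_ T′)

  -- Vacuous for l = ∞.
  NoneFreeFrom : ℕ∞ → Set (c ⊔ ℓ)
  NoneFreeFrom l =
    (T : List Carrier) → l ≤⁺ [ length T ] → ¬ IdempotentProductFree T

  IsErdősBurgessConstant : ℕ∞ → Set (c ⊔ ℓ)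
  IsErdősBurgessConstant l =
    NoneFreeFrom l × ((m : ℕ∞) → NoneFreeFrom m → l ≤⁺ m)

module _ {c ℓ : Level} (G : AbelianGroup c ℓ) where
  open AbelianGroup G

  IdentityProductFrom : ℕ → Set (c ⊔ ℓ)
  IdentityProductFrom l =
    (T : List Carrier) → l ℕ.≤ length T →
    Σ (List⁺ Carrier) λ T′ → toList T′ ⊆ T × foldr₁ _∙_ T′ ≈ ε

  IsDavenportConstant : ℕ → Set (c ⊔ ℓ)
  IsDavenportConstant d =
    1 ℕ.≤ d × IdentityProductFrom d ×
    ((m : ℕ) → 1 ℕ.≤ m → IdentityProductFrom m → d ℕ.≤ m)

module _ {c ℓ : Level} (M : CommutativeMonoid c ℓ) where
  open CommutativeMonoid M
  open Definitions _≈_ using (Invertible)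
  open CommutativeSemigroupProperties commutativeSemigroup using (interchange)

  private
    U : Set (c ⊔ ℓ)
    U = ∃ (Invertible ε _∙_)

    product≈ε : ∀ {x y x′ y′} → x′ ∙ x ≈ ε → y′ ∙ y ≈ ε → (x′ ∙ y′) ∙ (x ∙ y) ≈ ε
    product≈ε p q =
      trans (interchange _ _ _ _) (trans (∙-cong p q) (identityˡ ε))

    _∙ᵘ_ : U → U → U
    (x , x′ , x′x , xx′) ∙ᵘ (y , y′ , y′y , yy′) =
      x ∙ y , x′ ∙ y′ , product≈ε x′x y′y , product≈ε xx′ yy′

    _⁻¹ᵘ : U → U
    (x , x′ , x′x , xx′) ⁻¹ᵘ = x′ , x , xx′ , x′x

  unitGroup : AbelianGroup (c ⊔ ℓ) ℓ
  unitGroup = record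
    { Carrier = U
    ; _≈_ = λ u v → proj₁ u ≈ proj₁ v
    ; _∙_ = _∙ᵘ_
    ; ε = ε , ε , identityˡ ε , identityˡ ε
    ; _⁻¹ = _⁻¹ᵘ
    ; isAbelianGroup = record
      { isGroup = record
        { isMonoid = record
          { isSemigroup = record
            { isMagma = record
              { isEquivalence = record { refl = refl ; sym = sym ; trans = trans }
              ; ∙-cong = ∙-cong
              }
            ; assoc = λ u v w → assoc (proj₁ u) (proj₁ v) (proj₁ w)
            }
          ; identity = (λ u → identityˡ (proj₁ u)) , (λ u → identityʳ (proj₁ u))
          }
        ; inverse = (λ u → proj₁ (proj₂ (proj₂ u))) , (λ u → proj₂ (proj₂ (proj₂ u)))
        ; ⁻¹-cong = λ {u} {v} → inverse-cong u v
        }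
      ; comm = λ u v → comm (proj₁ u) (proj₁ v)
      }
    }
    where
    open SetoidReasoning setoid

    inverse-cong : (u v : U) → proj₁ u ≈ proj₁ v → proj₁ (u ⁻¹ᵘ) ≈ proj₁ (v ⁻¹ᵘ)
    inverse-cong (x , x′ , x′x , _) (y , y′ , _ , yy′) x≈y = begin
      x′             ≈⟨ identityʳ x′ ⟨
      x′ ∙ ε         ≈⟨ ∙-congˡ yy′ ⟨
      x′ ∙ (y ∙ y′)  ≈⟨ ∙-congˡ (∙-congʳ x≈y) ⟨
      x′ ∙ (x ∙ y′)  ≈⟨ assoc x′ x y′ ⟨
      (x′ ∙ x) ∙ y′  ≈⟨ ∙-congʳ x′x ⟩
      ε ∙ y′         ≈⟨ identityˡ y′ ⟩
      y′             ∎

-- The level of the membership predicate is the one at which products of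
-- ideals live.
record Ideal {c ℓ : Level} (R : CommutativeRing c ℓ) : Set (lsuc (c ⊔ ℓ)) where
  open CommutativeRing R
  field
    Member   : Pred Carrier (c ⊔ ℓ)
    respects : ∀ {x y} → x ≈ y → x ∈ Member → y ∈ Member
    0∈       : 0# ∈ Member
    +-closed : ∀ {x y} → x ∈ Member → y ∈ Member → x + y ∈ Member
    *-closed : ∀ r {x} → x ∈ Member → r * x ∈ Member

open Ideal public using (Member)

module _ {c ℓ : Level} {R : CommutativeRing c ℓ} where
  open CommutativeRing R

  IsZeroIdeal : Ideal R → Set (c ⊔ ℓ)
  IsZeroIdeal I = ∀ {x} → x ∈ Member I → x ≈ 0#

  IsNonzeroIdeal : Ideal R → Set (c ⊔ ℓ)
  IsNonzeroIdeal I = ∃[ x ] x ∈ Member I × ¬ x ≈ 0#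

  record IsPrimeIdeal (P : Ideal R) : Set (c ⊔ ℓ) where
    field
      proper : ¬ 1# ∈ Member P
      prime  : ∀ x y → x * y ∈ Member P → x ∈ Member P ⊎ y ∈ Member P

  unitIdeal : Ideal R
  unitIdeal = record
    { Member = λ _ → ⊤
    ; respects = λ _ _ → tt
    ; 0∈ = tt
    ; +-closed = λ _ _ → tt
    ; *-closed = λ _ _ → tt
    }

  -- The finite sums of products x * y with x ∈ I and y ∈ J.
  data ProductMember (I J : Ideal R) : Pred Carrier (c ⊔ ℓ) where
    product : ∀ {x y} → x ∈ Member I → y ∈ Member J → ProductMember I J (x * y)
    0-sum   : ProductMember I J 0#
    +-sum   : ∀ {x y} → ProductMember I J x → ProductMember I J y →
              ProductMember I J (x + y)
    ≈-sum   : ∀ {x y} → x ≈ y → ProductMember I J x → ProductMember I J y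

  infixl 7 _·_
  infixr 8 _^_

  _·_ : Ideal R → Ideal R → Ideal R
  I · J = record
    { Member = ProductMember I J
    ; respects = ≈-sum
    ; 0∈ = 0-sum
    ; +-closed = +-sum
    ; *-closed = *-closed
    }
    where
    *-closed : ∀ r {x} → ProductMember I J x → ProductMember I J (r * x)
    *-closed r (product {x} {y} x∈I y∈J) =
      ≈-sum (*-assoc r x y) (product (Ideal.*-closed I r x∈I) y∈J)
    *-closed r 0-sum = ≈-sum (sym (zeroʳ r)) 0-sum
    *-closed r (+-sum {x} {y} x∈ y∈) =
      ≈-sum (sym (distribˡ r x y)) (+-sum (*-closed r x∈) (*-closed r y∈))
    *-closed r (≈-sum x≈y x∈) = ≈-sum (*-congˡ x≈y) (*-closed r x∈)

  _^_ : Ideal R → ℕ → Ideal R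
  I ^ zero  = unitIdeal
  I ^ suc n = I · I ^ n

  ∏ : {r : ℕ} → (Fin r → Ideal R) → Ideal R
  ∏ = Vector.foldr _·_ unitIdeal

-- K = P₁^n₁ ⋯ Pᵣ^nᵣ with distinct prime ideals Pᵢ and nᵢ ≥ 1; r = 0 is allowed
-- and gives the unit ideal.  Since nᵢ ≥ 1, ω ≤ Ω and truncated subtraction of ω
-- is exact.  The zero ideal of a domain is itself prime and so has
-- factorizations in this sense; Ω and ω are meaningful for nonzero K only.
record Factorization {c ℓ : Level} {R : CommutativeRing c ℓ} (K : Ideal R) :
                     Set (lsuc (c ⊔ ℓ)) where
  field
    r          : ℕ
    P          : Fin r → Ideal R
    n          : Fin r → ℕ
    P-prime    : ∀ i → IsPrimeIdeal (P i)
    P-distinct : ∀ i j → i ≢ j → ¬ (Member (P i) ≐ Member (P j))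
    n≥1        : ∀ i → 1 ℕ.≤ n i
    factors    : Member K ≐ Member (∏ (λ i → P i ^ n i))

  Ω : ℕ
  Ω = Vector.foldr ℕ._+_ 0 n

  ω : ℕ
  ω = r

  IsPowerOfPrime : Set
  IsPowerOfPrime = r ≡ 1

  IsProductOfDistinctPrimes : Set
  IsProductOfDistinctPrimes = ∀ i → n i ≡ 1

module _ {c ℓ : Level} (R : CommutativeRing c ℓ) (I : Ideal R) where
  open CommutativeRing R
  open Ideal I hiding (Member)
  open RingProperties ring using (-1*x≈-x; -‿distribˡ-*; -‿distribʳ-*)
  open AbelianGroupProperties +-abelianGroup
    using (⁻¹-∙-comm; ⁻¹-anti-homo-//)
  open CommutativeSemigroupProperties +-commutativeSemigroup using (interchange)
  open SetoidReasoning setoid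

  infix 4 _≈_mod

  record _≈_mod (x y : Carrier) : Set (c ⊔ ℓ) where
    constructor congruent
    field difference : x - y ∈ Member I

  private
    -‿closed : ∀ {x} → x ∈ Member I → - x ∈ Member I
    -‿closed x∈ = respects (-1*x≈-x _) (*-closed (- 1#) x∈)

    ≈⇒mod : ∀ {x y} → x ≈ y → x ≈ y mod
    ≈⇒mod {x} {y} x≈y = congruent (respects eq 0∈)
      where
      eq : 0# ≈ x - y
      eq = trans (sym (-‿inverseʳ y)) (+-congʳ (sym x≈y))

    sym′ : ∀ {x y} → x ≈ y mod → y ≈ x mod
    sym′ (congruent d) = congruent (respects (⁻¹-anti-homo-// _ _) (-‿closed d))

    telescope : ∀ x y z → (x - y) + (y - z) ≈ x - z
    telescope x y z = begin
      (x - y) + (y - z)      ≈⟨ +-assoc x (- y) (y - z) ⟩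
      x + (- y + (y - z))    ≈⟨ +-congˡ (+-assoc (- y) y (- z)) ⟨
      x + ((- y + y) - z)    ≈⟨ +-congˡ (+-congʳ (-‿inverseˡ y)) ⟩
      x + (0# - z)           ≈⟨ +-congˡ (+-identityˡ (- z)) ⟩
      x - z                  ∎

    trans′ : ∀ {x y z} → x ≈ y mod → y ≈ z mod → x ≈ z mod
    trans′ (congruent d) (congruent e) =
      congruent (respects (telescope _ _ _) (+-closed d e))

    +-cong′ : ∀ {x y u v} → x ≈ y mod → u ≈ v mod → x + u ≈ y + v mod
    +-cong′ {x} {y} {u} {v} (congruent d) (congruent e) =
      congruent (respects eq (+-closed d e))
      where
      eq : (x - y) + (u - v) ≈ (x + u) - (y + v)
      eq = trans (interchange x (- y) u (- v)) (+-congˡ (⁻¹-∙-comm y v))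

    *-congˡ′ : ∀ x {u v} → u ≈ v mod → x * u ≈ x * v mod
    *-congˡ′ x {u} {v} (congruent e) = congruent (respects eq (*-closed x e))
      where
      eq : x * (u - v) ≈ x * u - x * v
      eq = trans (distribˡ x u (- v)) (+-congˡ (sym (-‿distribʳ-* x v)))

    *-cong′ : ∀ {x y u v} → x ≈ y mod → u ≈ v mod → x * u ≈ y * v mod
    *-cong′ {x} {y} {u} {v} p q =
      trans′ (*-congˡ′ x q)
        (trans′ (≈⇒mod (*-comm x v)) (trans′ (*-congˡ′ v p) (≈⇒mod (*-comm v y))))

    -‿cong′ : ∀ {x y} → x ≈ y mod → (- x) ≈ (- y) mod
    -‿cong′ {x} {y} (congruent d) =
      congruent (respects (sym (⁻¹-∙-comm x (- y))) (-‿closed d))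

  quotientRing : CommutativeRing c (c ⊔ ℓ)
  quotientRing = record
    { Carrier = Carrier
    ; _≈_ = _≈_mod
    ; _+_ = _+_
    ; _*_ = _*_
    ; -_ = -_
    ; 0# = 0#
    ; 1# = 1#
    ; isCommutativeRing = record
      { isRing = record
        { +-isAbelianGroup = record
          { isGroup = record
            { isMonoid = record
              { isSemigroup = record
                { isMagma = record
                  { isEquivalence = record
                    { refl = ≈⇒mod refl ; sym = sym′ ; trans = trans′ }
                  ; ∙-cong = +-cong′
                  }
                ; assoc = λ x y z → ≈⇒mod (+-assoc x y z)
                }
              ; identity = (λ x → ≈⇒mod (+-identityˡ x)) , (λ x → ≈⇒mod (+-identityʳ x))
              }
            ; inverse = (λ x → ≈⇒mod (-‿inverseˡ x)) , (λ x → ≈⇒mod (-‿inverseʳ x))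
            ; ⁻¹-cong = -‿cong′
            }
          ; comm = λ x y → ≈⇒mod (+-comm x y)
          }
        ; *-cong = *-cong′
        ; *-assoc = λ x y z → ≈⇒mod (*-assoc x y z)
        ; *-identity = (λ x → ≈⇒mod (*-identityˡ x)) , (λ x → ≈⇒mod (*-identityʳ x))
        ; distrib = (λ x y z → ≈⇒mod (distribˡ x y z)) , (λ x y z → ≈⇒mod (distribʳ x y z))
        }
      ; *-comm = λ x y → ≈⇒mod (*-comm x y)
      }
    }

module _ {c ℓ : Level} (R : CommutativeRing c ℓ) where
  open CommutativeRing R
  open RingProperties ring using (-0#≈0#)
  open CommutativeSemigroupProperties +-commutativeSemigroup
    using (interchange; x∙yz≈y∙xz)

  -- Coefficients in order of increasing degree; trailing zeros are allowed.
  coeff : List Carrier → ℕ → Carrier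
  coeff []      _       = 0#
  coeff (a ∷ p) zero    = a
  coeff (a ∷ p) (suc n) = coeff p n

  record _≈ₚ_ (p q : List Carrier) : Set ℓ where
    constructor coeffwise
    field coeff≈ : ∀ n → coeff p n ≈ coeff q n

  open _≈ₚ_ public

  infixl 6 _+ₚ_
  infixl 7 _*ₚ_
  infix  4 _≈ₚ_

  _+ₚ_ : List Carrier → List Carrier → List Carrier
  []      +ₚ q       = q
  (a ∷ p) +ₚ []      = a ∷ p
  (a ∷ p) +ₚ (b ∷ q) = (a + b) ∷ (p +ₚ q)

  -ₚ_ : List Carrier → List Carrier
  -ₚ_ = map (-_)

  scale : Carrier → List Carrier → List Carrier
  scale a = map (a *_)

  -- (a + x p) q = a q + x (p q)
  _*ₚ_ : List Carrier → List Carrier → List Carrier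
  []      *ₚ q = []
  (a ∷ p) *ₚ q = scale a q +ₚ (0# ∷ p *ₚ q)

  coeff-+ : ∀ p q n → coeff (p +ₚ q) n ≈ coeff p n + coeff q n
  coeff-+ []      q       n       = sym (+-identityˡ _)
  coeff-+ (a ∷ p) []      n       = sym (+-identityʳ _)
  coeff-+ (a ∷ p) (b ∷ q) zero    = refl
  coeff-+ (a ∷ p) (b ∷ q) (suc n) = coeff-+ p q n

  coeff-neg : ∀ p n → coeff (-ₚ p) n ≈ - coeff p n
  coeff-neg []      n       = sym -0#≈0#
  coeff-neg (a ∷ p) zero    = refl
  coeff-neg (a ∷ p) (suc n) = coeff-neg p n

  coeff-scale : ∀ a p n → coeff (scale a p) n ≈ a * coeff p n
  coeff-scale a []      n       = sym (zeroʳ a)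
  coeff-scale a (b ∷ p) zero    = refl
  coeff-scale a (b ∷ p) (suc n) = coeff-scale a p n

  private
    reflₚ : ∀ {p} → p ≈ₚ p
    reflₚ = coeffwise λ _ → refl

    symₚ : ∀ {p q} → p ≈ₚ q → q ≈ₚ p
    symₚ e = coeffwise λ n → sym (coeff≈ e n)

    transₚ : ∀ {p q s} → p ≈ₚ q → q ≈ₚ s → p ≈ₚ s
    transₚ d e = coeffwise λ n → trans (coeff≈ d n) (coeff≈ e n)

    +ₚ-cong : ∀ {p q s t} → p ≈ₚ q → s ≈ₚ t → p +ₚ s ≈ₚ q +ₚ t
    +ₚ-cong {p} {q} {s} {t} d e = coeffwise λ n →
      trans (coeff-+ p s n)
        (trans (+-cong (coeff≈ d n) (coeff≈ e n)) (sym (coeff-+ q t n)))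

    +ₚ-assoc : ∀ p q s → (p +ₚ q) +ₚ s ≈ₚ p +ₚ (q +ₚ s)
    +ₚ-assoc p q s = coeffwise λ n →
      trans (coeff-+ (p +ₚ q) s n)
        (trans (+-congʳ (coeff-+ p q n))
          (trans (+-assoc _ _ _)
            (trans (+-congˡ (sym (coeff-+ q s n))) (sym (coeff-+ p (q +ₚ s) n)))))

    +ₚ-comm : ∀ p q → p +ₚ q ≈ₚ q +ₚ p
    +ₚ-comm p q = coeffwise λ n →
      trans (coeff-+ p q n) (trans (+-comm _ _) (sym (coeff-+ q p n)))

    +ₚ-identityʳ : ∀ p → p +ₚ [] ≈ₚ p
    +ₚ-identityʳ p = +ₚ-comm p []

    -ₚ-cong : ∀ {p q} → p ≈ₚ q → -ₚ p ≈ₚ -ₚ q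
    -ₚ-cong {p} {q} e = coeffwise λ n →
      trans (coeff-neg p n) (trans (-‿cong (coeff≈ e n)) (sym (coeff-neg q n)))

    -ₚ-inverseˡ : ∀ p → (-ₚ p) +ₚ p ≈ₚ []
    -ₚ-inverseˡ p = coeffwise λ n →
      trans (coeff-+ (-ₚ p) p n) (trans (+-congʳ (coeff-neg p n)) (-‿inverseˡ _))

    -ₚ-inverseʳ : ∀ p → p +ₚ (-ₚ p) ≈ₚ []
    -ₚ-inverseʳ p = transₚ (+ₚ-comm p (-ₚ p)) (-ₚ-inverseˡ p)

    +ₚ-interchange : ∀ p q s t → (p +ₚ q) +ₚ (s +ₚ t) ≈ₚ (p +ₚ s) +ₚ (q +ₚ t)
    +ₚ-interchange p q s t = coeffwise λ n →
      trans (sums p q s t n) (trans (interchange _ _ _ _) (sym (sums p s q t n)))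
      where
      sums : ∀ p q s t n → coeff ((p +ₚ q) +ₚ (s +ₚ t)) n ≈
             (coeff p n + coeff q n) + (coeff s n + coeff t n)
      sums p q s t n =
        trans (coeff-+ (p +ₚ q) (s +ₚ t) n) (+-cong (coeff-+ p q n) (coeff-+ s t n))

    ∷-cong : ∀ {a b p q} → a ≈ b → p ≈ₚ q → (a ∷ p) ≈ₚ (b ∷ q)
    ∷-cong a≈b p≈q = coeffwise λ { zero → a≈b ; (suc n) → coeff≈ p≈q n }

    0∷[] : (0# ∷ []) ≈ₚ []
    0∷[] = coeffwise λ { zero → refl ; (suc n) → refl }

    tail-cong : ∀ {a b p q} → (a ∷ p) ≈ₚ (b ∷ q) → p ≈ₚ q
    tail-cong e = coeffwise λ n → coeff≈ e (suc n)

    tail-zero : ∀ {a p} → (a ∷ p) ≈ₚ [] → p ≈ₚ []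
    tail-zero e = coeffwise λ n → coeff≈ e (suc n)

    scale-cong : ∀ {a b p q} → a ≈ b → p ≈ₚ q → scale a p ≈ₚ scale b q
    scale-cong {a} {b} {p} {q} a≈b p≈q = coeffwise λ n →
      trans (coeff-scale a p n)
        (trans (*-cong a≈b (coeff≈ p≈q n)) (sym (coeff-scale b q n)))

    scale-zero : ∀ {a} p → a ≈ 0# → scale a p ≈ₚ []
    scale-zero {a} p a≈0 = coeffwise λ n →
      trans (coeff-scale a p n) (trans (*-congʳ a≈0) (zeroˡ _))

    scale-one : ∀ p → scale 1# p ≈ₚ p
    scale-one p = coeffwise λ n → trans (coeff-scale 1# p n) (*-identityˡ _)

    scale-+ˡ : ∀ a b p → scale (a + b) p ≈ₚ scale a p +ₚ scale b p
    scale-+ˡ a b p = coeffwise λ n →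
      trans (coeff-scale (a + b) p n)
        (trans (distribʳ _ a b)
          (trans (+-cong (sym (coeff-scale a p n)) (sym (coeff-scale b p n)))
            (sym (coeff-+ (scale a p) (scale b p) n))))

    scale-+ʳ : ∀ a p q → scale a (p +ₚ q) ≈ₚ scale a p +ₚ scale a q
    scale-+ʳ a p q = coeffwise λ n →
      trans (coeff-scale a (p +ₚ q) n)
        (trans (*-congˡ (coeff-+ p q n))
          (trans (distribˡ a _ _)
            (trans (+-cong (sym (coeff-scale a p n)) (sym (coeff-scale a q n)))
              (sym (coeff-+ (scale a p) (scale a q) n)))))

    scale-scale : ∀ a b p → scale (a * b) p ≈ₚ scale a (scale b p)
    scale-scale a b p = coeffwise λ n →
      trans (coeff-scale (a * b) p n)
        (trans (*-assoc a b _)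
          (trans (*-congˡ (sym (coeff-scale b p n)))
            (sym (coeff-scale a (scale b p) n))))

    shift-+ : ∀ p q → (0# ∷ p +ₚ q) ≈ₚ (0# ∷ p) +ₚ (0# ∷ q)
    shift-+ p q = ∷-cong (sym (+-identityˡ 0#)) reflₚ

    shift-scale : ∀ a p → (0# ∷ scale a p) ≈ₚ scale a (0# ∷ p)
    shift-scale a p = ∷-cong (sym (zeroʳ a)) reflₚ

    *ₚ-zeroˡ : ∀ p q → p ≈ₚ [] → p *ₚ q ≈ₚ []
    *ₚ-zeroˡ []      q e = reflₚ
    *ₚ-zeroˡ (a ∷ p) q e =
      +ₚ-cong (scale-zero q (coeff≈ e 0))
        (transₚ (∷-cong refl (*ₚ-zeroˡ p q (tail-zero e))) 0∷[])

    *ₚ-congʳ : ∀ p q s → p ≈ₚ q → p *ₚ s ≈ₚ q *ₚ s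
    *ₚ-congʳ []      q       s e = symₚ (*ₚ-zeroˡ q s (symₚ e))
    *ₚ-congʳ (a ∷ p) []      s e = *ₚ-zeroˡ (a ∷ p) s e
    *ₚ-congʳ (a ∷ p) (b ∷ q) s e =
      +ₚ-cong (scale-cong (coeff≈ e 0) reflₚ)
        (∷-cong refl (*ₚ-congʳ p q s (tail-cong e)))

    *ₚ-zeroʳ : ∀ p → p *ₚ [] ≈ₚ []
    *ₚ-zeroʳ []      = reflₚ
    *ₚ-zeroʳ (a ∷ p) = transₚ (∷-cong refl (*ₚ-zeroʳ p)) 0∷[]

    *ₚ-∷ : ∀ p b q → p *ₚ (b ∷ q) ≈ₚ scale b p +ₚ (0# ∷ p *ₚ q)
    *ₚ-∷ []      b q = symₚ 0∷[]
    *ₚ-∷ (a ∷ p) b q = ∷-cong (+-congʳ (*-comm a b))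
      (transₚ (+ₚ-cong reflₚ (*ₚ-∷ p b q))
        (swap (scale a q) (scale b p) (0# ∷ p *ₚ q)))
      where
      swap : ∀ p q s → p +ₚ (q +ₚ s) ≈ₚ q +ₚ (p +ₚ s)
      swap p q s = transₚ (symₚ (+ₚ-assoc p q s))
        (transₚ (+ₚ-cong (+ₚ-comm p q) reflₚ) (+ₚ-assoc q p s))

    *ₚ-comm : ∀ p q → p *ₚ q ≈ₚ q *ₚ p
    *ₚ-comm []      q = symₚ (*ₚ-zeroʳ q)
    *ₚ-comm (a ∷ p) q =
      transₚ (+ₚ-cong reflₚ (∷-cong refl (*ₚ-comm p q))) (symₚ (*ₚ-∷ q a p))

    *ₚ-cong : ∀ {p q s t} → p ≈ₚ q → s ≈ₚ t → p *ₚ s ≈ₚ q *ₚ t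
    *ₚ-cong {p} {q} {s} {t} d e =
      transₚ (*ₚ-congʳ p q s d)
        (transₚ (*ₚ-comm q s) (transₚ (*ₚ-congʳ s t q e) (*ₚ-comm t q)))

    *ₚ-distribʳ : ∀ s p q → (p +ₚ q) *ₚ s ≈ₚ p *ₚ s +ₚ q *ₚ s
    *ₚ-distribʳ s []      q       = reflₚ
    *ₚ-distribʳ s (a ∷ p) []      = symₚ (+ₚ-identityʳ _)
    *ₚ-distribʳ s (a ∷ p) (b ∷ q) =
      transₚ
        (+ₚ-cong (scale-+ˡ a b s)
          (transₚ (∷-cong refl (*ₚ-distribʳ s p q)) (shift-+ (p *ₚ s) (q *ₚ s))))
        (+ₚ-interchange (scale a s) (scale b s) (0# ∷ p *ₚ s) (0# ∷ q *ₚ s))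

    *ₚ-distribˡ : ∀ s p q → s *ₚ (p +ₚ q) ≈ₚ s *ₚ p +ₚ s *ₚ q
    *ₚ-distribˡ s p q =
      transₚ (*ₚ-comm s (p +ₚ q))
        (transₚ (*ₚ-distribʳ s p q) (+ₚ-cong (*ₚ-comm p s) (*ₚ-comm q s)))

    scale-* : ∀ a p q → scale a p *ₚ q ≈ₚ scale a (p *ₚ q)
    scale-* a []      q = reflₚ
    scale-* a (b ∷ p) q =
      transₚ
        (+ₚ-cong (scale-scale a b q)
          (transₚ (∷-cong refl (scale-* a p q)) (shift-scale a (p *ₚ q))))
        (symₚ (scale-+ʳ a (scale b q) (0# ∷ p *ₚ q)))

    *ₚ-assoc : ∀ p q s → (p *ₚ q) *ₚ s ≈ₚ p *ₚ (q *ₚ s)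
    *ₚ-assoc []      q s = reflₚ
    *ₚ-assoc (a ∷ p) q s =
      transₚ (*ₚ-distribʳ s (scale a q) (0# ∷ p *ₚ q))
        (+ₚ-cong (scale-* a q s)
          (+ₚ-cong (scale-zero s refl) (∷-cong refl (*ₚ-assoc p q s))))

    *ₚ-identityˡ : ∀ p → (1# ∷ []) *ₚ p ≈ₚ p
    *ₚ-identityˡ p =
      transₚ (+ₚ-cong (scale-one p) 0∷[]) (+ₚ-identityʳ p)

  polynomialRing : CommutativeRing c ℓ
  polynomialRing = record
    { Carrier = List Carrier
    ; _≈_ = _≈ₚ_
    ; _+_ = _+ₚ_
    ; _*_ = _*ₚ_
    ; -_ = -ₚ_
    ; 0# = []
    ; 1# = 1# ∷ []
    ; isCommutativeRing = record
      { isRing = record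
        { +-isAbelianGroup = record
          { isGroup = record
            { isMonoid = record
              { isSemigroup = record
                { isMagma = record
                  { isEquivalence = record { refl = reflₚ ; sym = symₚ ; trans = transₚ }
                  ; ∙-cong = +ₚ-cong
                  }
                ; assoc = +ₚ-assoc
                }
              ; identity = (λ _ → reflₚ) , +ₚ-identityʳ
              }
            ; inverse = -ₚ-inverseˡ , -ₚ-inverseʳ
            ; ⁻¹-cong = -ₚ-cong
            }
          ; comm = +ₚ-comm
          }
        ; *-cong = *ₚ-cong
        ; *-assoc = *ₚ-assoc
        ; *-identity = *ₚ-identityˡ
            , λ p → transₚ (*ₚ-comm p (1# ∷ [])) (*ₚ-identityˡ p)
        ; distrib = *ₚ-distribˡ , *ₚ-distribʳ
        }
      ; *-comm = *ₚ-comm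
      }
    }

IsPrimePower : ℕ → Set
IsPrimePower q = ∃[ p ] ∃[ k ] Prime p × 1 ℕ.≤ k × q ≡ p ℕ.^ k

record FiniteField (c ℓ : Level) (q : ℕ) : Set (lsuc (c ⊔ ℓ)) where
  field
    commutativeRing : CommutativeRing c ℓ

  open CommutativeRing commutativeRing
  open Definitions _≈_ using (Invertible)

  field
    0≉1         : ¬ 0# ≈ 1#
    invertible  : ∀ x → ¬ x ≈ 0# → Invertible 1# _*_ x
    cardinality : Inverse setoid (≡.setoid (Fin q))

_[x] : {c ℓ : Level} {q : ℕ} → FiniteField c ℓ q → CommutativeRing c ℓ
F [x] = polynomialRing (FiniteField.commutativeRing F)

multiplicativeSemigroup : {c ℓ : Level} → CommutativeRing c ℓ → CommutativeSemigroup c ℓ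
multiplicativeSemigroup R =
  CommutativeMonoid.commutativeSemigroup (CommutativeRing.*-commutativeMonoid R)

units : {c ℓ : Level} → CommutativeRing c ℓ → AbelianGroup (c ⊔ ℓ) ℓ
units R = unitGroup (CommutativeRing.*-commutativeMonoid R)

{-# OPTIONS --safe #-}
module Submission where

-- Call l unavoidable for a finite commutative monoid if every sequence of length at least l has a
-- nonempty subsequence with idempotent product.  Some l is, since every element has an idempotent
-- power, so the least one is found by search: it is I for the monoid, and D for a group, whose
-- only idempotent is the identity.
--
-- For a prime P ⊇ K, an idempotent power e of x modulo K satisfies e(e - 1) ∈ P, so that x ∈ P or
-- x is invertible modulo P.  Hence P is decidable and maximal, and by division with remainder it
-- is generated by some p.
--
-- Lower bound: append nᵢ - 1 copies of each generator pᵢ to a sequence of units without identity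
-- subproducts.  An idempotent modulo Pᵢ^nᵢ has Pᵢ-valuation 0 or at least nᵢ, so an idempotent
-- subproduct involves no pᵢ, and is then a product of units.
--
-- Upper bound: modulo Pⁿ, among D + n - 1 elements there are n in P, whose product is 0, or D
-- units.  Modulo distinct primes, replace x by the unit x + ∏ pᵢ over the i with x ∉ Pᵢ.  Where
-- none of the x in a subsequence lies in Pᵢ this changes nothing modulo Pᵢ, and elsewhere the
-- product of the x is 0 modulo Pᵢ; so identity products of the new terms come from idempotents.

open import Defs
open import Algebra.Bundles using (AbelianGroup; CommutativeMonoid; CommutativeRing)
import Algebra.Definitions as Definitions
import Algebra.Properties.AbelianGroup as AbelianGroupProperties
import Algebra.Properties.CommutativeSemigroup as CommutativeSemigroupProperties
import Algebra.Properties.CommutativeSemigroup.Divisibility as Divisibility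
import Algebra.Properties.Group as GroupProperties
import Algebra.Properties.Monoid.Mult as MonoidMult
import Algebra.Properties.Ring as RingProperties
import Algebra.Properties.Semiring.Exp as Exp
open import Data.Fin.Base as Fin using (Fin; toℕ; finToFun; funToFin)
import Data.Fin.Properties as Fin
open import Data.List.Base
  using (List; []; _∷_; _++_; length; map; foldr; filter; take; drop; replicate; tabulate;
         allFin)
open import Data.List.Membership.Propositional using (_∈_)
open import Data.List.Membership.Propositional.Properties using (∈-allFin)
open import Data.List.NonEmpty.Base using (_∷_; toList; foldr₁)
open import Data.List.Properties
  using (++-identityʳ; filter-++; filter-all; filter-none; length-++; length-map;
         length-replicate; length-take)
open import Data.List.Relation.Binary.Sublist.Propositional using (_⊆_; []; _∷ʳ_; _∷_; ⊆-trans)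
import Data.List.Relation.Binary.Sublist.Propositional.Properties as Sublist
open import Data.List.Relation.Unary.All as All using (All; []; _∷_)
import Data.List.Relation.Unary.All.Properties as All
open import Data.List.Relation.Unary.Any as Any using (Any; here; there)
open import Data.Nat.Base as ℕ using (ℕ; zero; suc; _∸_; _≤_; _<_; z≤n; s≤s)
import Data.Nat.Properties as ℕ
open import Data.Product.Base using (∃; ∃-syntax; _×_; _,_; proj₁; proj₂)
open import Data.Sum.Base using (_⊎_; inj₁; inj₂; [_,_]′)
open import Data.Unit.Polymorphic.Base using (tt)
import Data.Vec.Functional as Vector
open import Function.Base using (_∘_; id)
open import Function.Bundles using (Inverse; Surjection)
open import Level using (Level; _⊔_) renaming (suc to lsuc)
open import Relation.Binary.Bundles using (Setoid)
open import Relation.Binary.Construct.Add.Supremum.NonStrict ℕ._≤_ using (_≤⁺_; [_]; _≤⊤⁺)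
open import Relation.Binary.Definitions using (Decidable; tri<; tri≈; tri>)
open import Relation.Binary.PropositionalEquality as ≡ using (_≡_; _≢_; cong; subst)
import Relation.Binary.Reasoning.Setoid as SetoidReasoning
open import Relation.Nullary.Construct.Add.Supremum using (⊤⁺; [_])
open import Relation.Nullary.Decidable
  using (Dec; yes; no; map′; ¬?; decidable-stable; _×-dec_; _⊎-dec_)
open import Relation.Nullary.Negation using (¬_; contradiction)
import Relation.Unary as U

private variable
  a b c ℓ : Level
  A : Set a
  B : Set b

-- Lists

⊆-map⁻ : (f : A → B) {ys : List B} (xs : List A) → ys ⊆ map f xs →
         ∃[ zs ] zs ⊆ xs × ys ≡ map f zs
⊆-map⁻ f []       []       = [] , [] , ≡.refl
⊆-map⁻ f (x ∷ xs) (_ ∷ʳ s) with zs , t , e ← ⊆-map⁻ f xs s = zs , x ∷ʳ t , e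
⊆-map⁻ f (x ∷ xs) (≡.refl ∷ s) with zs , t , ≡.refl ← ⊆-map⁻ f xs s =
  x ∷ zs , ≡.refl ∷ t , ≡.refl

anySublist? : {P : List A → Set ℓ} → U.Decidable P → ∀ xs → Dec (∃[ ys ] ys ⊆ xs × P ys)
anySublist? P? [] = map′ (λ h → [] , [] , h) (λ { (_ , [] , h) → h }) (P? [])
anySublist? P? (x ∷ xs) =
  map′ (λ { (inj₁ (ys , s , h)) → x ∷ ys , ≡.refl ∷ s , h
          ; (inj₂ (ys , s , h)) → ys , x ∷ʳ s , h })
       (λ { (_ , _ ∷ʳ s , h) → inj₂ (_ , s , h)
          ; (_ , ≡.refl ∷ s , h) → inj₁ (_ , s , h) })
       (anySublist? (P? ∘ (x ∷_)) xs ⊎-dec anySublist? P? xs)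

anyList? : ∀ {N} {P : List (Fin N) → Set ℓ} → U.Decidable P →
           ∀ l → Dec (∃[ v ] length v ≡ l × P v)
anyList? P? zero = map′ (λ h → [] , ≡.refl , h) (λ { ([] , _ , h) → h }) (P? [])
anyList? P? (suc l) =
  map′ (λ { (i , v , e , h) → i ∷ v , cong suc e , h })
       (λ { (i ∷ v , e , h) → i , v , ℕ.suc-injective e , h })
       (Fin.any? λ i → anyList? (P? ∘ (i ∷_)) l)

length-filter-¬ : {P : A → Set ℓ} (P? : U.Decidable P) (xs : List A) →
                  length xs ≡ length (filter P? xs) ℕ.+ length (filter (¬? ∘ P?) xs)
length-filter-¬ P? [] = ≡.refl
length-filter-¬ P? (x ∷ xs) with P? x
... | yes _ = cong suc (length-filter-¬ P? xs)
... | no  _ = ≡.trans (cong suc (length-filter-¬ P? xs)) (≡.sym (ℕ.+-suc _ _))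

-- Separates units from repeated generators in the lower bound, where `Q` says that an element
-- avoids every prime.
⊆-++⁻ˡ : {Q : B → Set ℓ} (xs : List B) {ys zs : List B} → All Q zs → All (¬_ ∘ Q) ys →
         zs ⊆ xs ++ ys → zs ⊆ xs
⊆-++⁻ˡ []       {zs = []}    _       _  _ = []
⊆-++⁻ˡ []       {zs = _ ∷ _} (q ∷ _) ¬qs s =
  contradiction q (All.lookup ¬qs (Sublist.Any-resp-⊆ s (here ≡.refl)))
⊆-++⁻ˡ (x ∷ xs) qs       ¬qs (_ ∷ʳ s) = x ∷ʳ ⊆-++⁻ˡ xs qs ¬qs s
⊆-++⁻ˡ (x ∷ xs) (_ ∷ qs) ¬qs (e ∷ s)  = e ∷ ⊆-++⁻ˡ xs qs ¬qs s

filter-empty⁻ : {Q : B → Set ℓ} (Q? : U.Decidable Q) (xs : List B) →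
                length (filter Q? xs) ≡ 0 → All (¬_ ∘ Q) xs
filter-empty⁻ Q? []       _ = []
filter-empty⁻ Q? (x ∷ xs) e with Q? x
... | no ¬q = ¬q ∷ filter-empty⁻ Q? xs e

foldr-const-1 : ∀ {r} (n : Fin r → ℕ) → (∀ i → n i ≡ 1) → Vector.foldr ℕ._+_ 0 n ≡ r
foldr-const-1 {zero}  n n≡1 = ≡.refl
foldr-const-1 {suc r} n n≡1 = ≡.cong₂ ℕ._+_ (n≡1 Fin.zero)
  (foldr-const-1 (n ∘ Fin.suc) (n≡1 ∘ Fin.suc))

module _ {B : Set b} where

  repeats : ∀ {r} → (Fin r → ℕ) → (Fin r → B) → List B
  repeats {zero}  n p = []
  repeats {suc r} n p =
    replicate (n Fin.zero ∸ 1) (p Fin.zero) ++ repeats (n ∘ Fin.suc) (p ∘ Fin.suc)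

  -- Stated with `r` added on the left, so that no truncated difference of `Ω` and `ω` has to be
  -- handled; `n≥1` makes each `n i ∸ 1` exact.
  length-repeats : ∀ {r} (n : Fin r → ℕ) (p : Fin r → B) → (∀ i → 1 ≤ n i) →
                   length (repeats n p) ℕ.+ r ≡ Vector.foldr ℕ._+_ 0 n
  length-repeats {zero}  n p n≥1 = ≡.refl
  length-repeats {suc r} n p n≥1 = begin
    length (xs ++ ys) ℕ.+ suc r           ≡⟨ cong (ℕ._+ suc r) (length-++ xs) ⟩
    length xs ℕ.+ length ys ℕ.+ suc r     ≡⟨ cong (λ m → m ℕ.+ length ys ℕ.+ suc r)
                                               (length-replicate n₀) ⟩
    n₀ ℕ.+ length ys ℕ.+ suc r            ≡⟨ ℕ.+-assoc n₀ _ _ ⟩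
    n₀ ℕ.+ (length ys ℕ.+ suc r)          ≡⟨ cong (n₀ ℕ.+_) (ℕ.+-suc _ r) ⟩
    n₀ ℕ.+ suc (length ys ℕ.+ r)          ≡⟨ ℕ.+-suc n₀ _ ⟩
    suc n₀ ℕ.+ (length ys ℕ.+ r)          ≡⟨ ≡.cong₂ ℕ._+_ (ℕ.m+[n∸m]≡n (n≥1 Fin.zero))
                                               (length-repeats _ _ (n≥1 ∘ Fin.suc)) ⟩
    Vector.foldr ℕ._+_ 0 n                ∎
    where
    open ≡.≡-Reasoning
    n₀ = n Fin.zero ∸ 1
    xs = replicate n₀ (p Fin.zero)
    ys = repeats (n ∘ Fin.suc) (p ∘ Fin.suc)

  all-repeats : ∀ {r} {Q : B → Set a} (n : Fin r → ℕ) (p : Fin r → B) → (∀ i → Q (p i)) →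
                All Q (repeats n p)
  all-repeats {r = zero}  n p q = []
  all-repeats {r = suc r} n p q =
    All.++⁺ (All.replicate⁺ (n Fin.zero ∸ 1) (q Fin.zero))
      (all-repeats (n ∘ Fin.suc) (p ∘ Fin.suc) (q ∘ Fin.suc))

  length-filter-repeats : ∀ {r} {Q : B → Set a} (Q? : U.Decidable Q)
    (n : Fin r → ℕ) (p : Fin r → B) i →
    Q (p i) → (∀ j → j ≢ i → ¬ Q (p j)) → length (filter Q? (repeats n p)) ≡ n i ∸ 1
  length-filter-repeats Q? n p Fin.zero q ¬q = begin
    length (filter Q? (xs ++ ys))           ≡⟨ cong length (filter-++ Q? xs ys) ⟩
    length (filter Q? xs ++ filter Q? ys)   ≡⟨ cong length (≡.cong₂ _++_ all none) ⟩
    length (xs ++ [])                       ≡⟨ cong length (++-identityʳ xs) ⟩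
    length xs                               ≡⟨ length-replicate _ ⟩
    n Fin.zero ∸ 1                          ∎
    where
    open ≡.≡-Reasoning
    all = filter-all Q? (All.replicate⁺ (n Fin.zero ∸ 1) q)
    none = filter-none Q? (all-repeats (n ∘ Fin.suc) (p ∘ Fin.suc) λ j → ¬q (Fin.suc j) λ ())
    xs = replicate (n Fin.zero ∸ 1) (p Fin.zero)
    ys = repeats (n ∘ Fin.suc) (p ∘ Fin.suc)
  length-filter-repeats Q? n p (Fin.suc i) q ¬q = begin
    length (filter Q? (xs ++ ys))           ≡⟨ cong length (filter-++ Q? xs ys) ⟩
    length (filter Q? xs ++ filter Q? ys)   ≡⟨ cong (λ zs → length (zs ++ filter Q? ys)) none ⟩
    length (filter Q? ys)                   ≡⟨ length-filter-repeats Q? _ _ i q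
                                                 (λ j j≢i → ¬q (Fin.suc j) (j≢i ∘ Fin.suc-injective)) ⟩
    n (Fin.suc i) ∸ 1                       ∎
    where
    open ≡.≡-Reasoning
    none = filter-none Q? (All.replicate⁺ (n Fin.zero ∸ 1) (¬q Fin.zero λ ()))
    xs = replicate (n Fin.zero ∸ 1) (p Fin.zero)
    ys = repeats (n ∘ Fin.suc) (p ∘ Fin.suc)

-- Idempotent products in finite commutative monoids

-- A surjection suffices, so `N` only bounds the cardinality. This lets the same `N` serve a monoid
-- and its group of units.
Finite : Setoid c ℓ → ℕ → Set _
Finite S N = Surjection (≡.setoid (Fin N)) S

module _ (M : CommutativeMonoid c ℓ) where
  open CommutativeMonoid M
  -- The monoid is treated as additive here: `m ⋆ x` is the `m`-th power of `x`.
  open MonoidMult monoid using () renaming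
    (_×_ to _⋆_; ×-congˡ to ⋆-congˡ; ×-homo-+ to ⋆-homo-+)

  prod : List Carrier → Carrier
  prod = foldr _∙_ ε

  Idempotent : Carrier → Set ℓ
  Idempotent x = x ∙ x ≈ x

  -- Plain lists with a length condition take the place of `List⁺`, which suits searching and
  -- filtering; `foldr₁≈prod` links the two forms.
  HasIdempotent : List Carrier → Set _
  HasIdempotent T = ∃[ T′ ] T′ ⊆ T × 0 < length T′ × Idempotent (prod T′)

  HasIdentity : List Carrier → Set _
  HasIdentity T = ∃[ T′ ] T′ ⊆ T × 0 < length T′ × prod T′ ≈ ε

  Unavoidable : ℕ → Set _
  Unavoidable l = ∀ T → l ≤ length T → HasIdempotent T

  idempotent-resp : ∀ {x y} → x ≈ y → Idempotent x → Idempotent y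
  idempotent-resp x≈y xx≈x =
    trans (∙-cong (sym x≈y) (sym x≈y)) (trans xx≈x x≈y)

  ≈ε⇒idempotent : ∀ {x} → x ≈ ε → Idempotent x
  ≈ε⇒idempotent x≈ε = idempotent-resp (sym x≈ε) (identityˡ ε)

  foldr₁≈prod : ∀ x xs → foldr₁ _∙_ (x ∷ xs) ≈ prod (x ∷ xs)
  foldr₁≈prod x []       = sym (identityʳ x)
  foldr₁≈prod x (y ∷ xs) = ∙-congˡ (foldr₁≈prod y xs)

  prod-constant : ∀ {x} T → All (_≈ x) T → prod T ≈ length T ⋆ x
  prod-constant []      []       = refl
  prod-constant (y ∷ T) (e ∷ es) = ∙-cong e (prod-constant T es)

  hasIdentity⇒hasIdempotent : ∀ {T} → HasIdentity T → HasIdempotent T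
  hasIdentity⇒hasIdempotent (T′ , s , 0<len , e) = T′ , s , 0<len , ≈ε⇒idempotent e

  hasIdempotent-mono : ∀ {T T₁} → T ⊆ T₁ → HasIdempotent T → HasIdempotent T₁
  hasIdempotent-mono s (T′ , s′ , h) = T′ , ⊆-trans s′ s , h

  ¬hasIdempotent⇒free : ∀ {T} → ¬ HasIdempotent T →
                        IdempotentProductFree commutativeSemigroup T
  ¬hasIdempotent⇒free ¬h (x ∷ xs) s idem =
    ¬h (x ∷ xs , s , s≤s z≤n , idempotent-resp (foldr₁≈prod x xs) idem)

  hasIdempotent⇒¬free : ∀ {T} → HasIdempotent T →
                        ¬ IdempotentProductFree commutativeSemigroup T
  hasIdempotent⇒¬free (x ∷ xs , s , _ , idem) free =
    free (x ∷ xs) s (idempotent-resp (sym (foldr₁≈prod x xs)) idem)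

  -- Minimality is recorded by an avoiding sequence of length exactly `d - 1`. For the unit group,
  -- this is the sequence that the lower bound extends.
  IsLeastUnavoidable : ℕ → Set _
  IsLeastUnavoidable d = Unavoidable d × ∃[ T ] d ≡ suc (length T) × ¬ HasIdempotent T

  leastUnavoidable⇒ErdősBurgess :
    ∀ {d} → IsLeastUnavoidable d → IsErdősBurgessConstant commutativeSemigroup [ d ]
  leastUnavoidable⇒ErdősBurgess (un , T , ≡.refl , ¬h) =
    (λ { T′ [ le ] → hasIdempotent⇒¬free (un T′ le) }) , least
    where
    least : ∀ m → NoneFreeFrom commutativeSemigroup m → [ suc (length T) ] ≤⁺ m
    least ⊤⁺    _ = _ ≤⊤⁺
    least [ m ] h = [ ℕ.≰⇒> (λ m≤ → h T [ m≤ ] (¬hasIdempotent⇒free ¬h)) ]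

  leastUnavoidable⇒≤ : ∀ {d l} → IsLeastUnavoidable d → Unavoidable l → d ≤ l
  leastUnavoidable⇒≤ (_ , T , ≡.refl , ¬h) un = ℕ.≰⇒> λ l≤ → ¬h (un T l≤)

  module _ {N : ℕ} (finite : Finite setoid N) where
    open Surjection finite using (to; to⁻; to∘to⁻)

    -- x^a ≈ x^(a+d) with d ≥ 1, so the exponent m = (1+a)d ≥ a satisfies x^(m+m) ≈ x^m.
    idempotentPower : ∀ x → ∃[ m ] 1 ≤ m × Idempotent (m ⋆ x)
    idempotentPower x
      with i , j , i<j , eq ← Fin.pigeonhole (ℕ.n<1+n N) (λ i → to⁻ (toℕ i ⋆ x))
      = m , ℕ.≤-trans 1≤d (ℕ.m≤m+n d (toℕ i ℕ.* d)) , idem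
      where
      d = toℕ j ∸ toℕ i
      m = suc (toℕ i) ℕ.* d
      1≤d : 1 ≤ d
      1≤d = ℕ.m<n⇒0<n∸m i<j
      xⁱ≈xʲ : toℕ i ⋆ x ≈ toℕ j ⋆ x
      xⁱ≈xʲ = trans (sym (to∘to⁻ _)) (trans (reflexive (cong to eq)) (to∘to⁻ _))
      d+i≡j : d ℕ.+ toℕ i ≡ toℕ j
      d+i≡j = ℕ.m∸n+n≡m (ℕ.<⇒≤ i<j)
      open SetoidReasoning setoid
      period : ∀ t → toℕ i ≤ t → (d ℕ.+ t) ⋆ x ≈ t ⋆ x
      period t i≤t = begin
        (d ℕ.+ t) ⋆ x                        ≡⟨ cong (λ k → (d ℕ.+ k) ⋆ x) (≡.sym (ℕ.m+[n∸m]≡n i≤t)) ⟩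
        (d ℕ.+ (toℕ i ℕ.+ (t ∸ toℕ i))) ⋆ x  ≡⟨ cong (_⋆ x) (≡.sym (ℕ.+-assoc d _ _)) ⟩
        (d ℕ.+ toℕ i ℕ.+ (t ∸ toℕ i)) ⋆ x    ≡⟨ cong (λ k → (k ℕ.+ (t ∸ toℕ i)) ⋆ x) d+i≡j ⟩
        (toℕ j ℕ.+ (t ∸ toℕ i)) ⋆ x          ≈⟨ ⋆-homo-+ x (toℕ j) _ ⟩
        toℕ j ⋆ x ∙ (t ∸ toℕ i) ⋆ x          ≈⟨ ∙-congʳ xⁱ≈xʲ ⟨
        toℕ i ⋆ x ∙ (t ∸ toℕ i) ⋆ x          ≈⟨ ⋆-homo-+ x (toℕ i) _ ⟨
        (toℕ i ℕ.+ (t ∸ toℕ i)) ⋆ x          ≡⟨ cong (_⋆ x) (ℕ.m+[n∸m]≡n i≤t) ⟩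
        t ⋆ x                                ∎
      periods : ∀ k t → toℕ i ≤ t → (k ℕ.* d ℕ.+ t) ⋆ x ≈ t ⋆ x
      periods zero    t i≤t = refl
      periods (suc k) t i≤t = begin
        (d ℕ.+ k ℕ.* d ℕ.+ t) ⋆ x    ≡⟨ cong (_⋆ x) (ℕ.+-assoc d _ _) ⟩
        (d ℕ.+ (k ℕ.* d ℕ.+ t)) ⋆ x  ≈⟨ period _ (ℕ.≤-trans i≤t (ℕ.m≤n+m t _)) ⟩
        (k ℕ.* d ℕ.+ t) ⋆ x          ≈⟨ periods k t i≤t ⟩
        t ⋆ x                        ∎
      i≤m : toℕ i ≤ m
      i≤m = ℕ.≤-trans (ℕ.n≤1+n _)
        (ℕ.≤-trans (ℕ.≤-reflexive (≡.sym (ℕ.*-identityʳ _))) (ℕ.*-monoʳ-≤ (suc (toℕ i)) 1≤d))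
      idem : Idempotent (m ⋆ x)
      idem = trans (sym (⋆-homo-+ x m m)) (periods (suc (toℕ i)) m i≤m)

    -- Induction on the classes allowed to occur. Either class `i` occurs `m` times, and `m` copies
    -- multiply to its idempotent power, or fewer than `m` terms are lost by discarding it and at
    -- least `B` remain in the other classes. With no class allowed, a sequence of length 1 is
    -- already impossible.
    unavoidable-within : (is : List (Fin N)) →
      ∃[ B ] ∀ T → All (λ x → to⁻ x ∈ is) T → B ≤ length T → HasIdempotent T
    unavoidable-within [] = 1 , λ { (x ∷ T) (() ∷ _) _ }
    unavoidable-within (i ∷ is)
      with B , un ← unavoidable-within is | m , 1≤m , idem ← idempotentPower (to i)
      = m ℕ.+ B , has
      where
      class? : U.Decidable (λ x → to⁻ x ≡ i)
      class? x = to⁻ x Fin.≟ i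
      rest : ∀ {x} → (to⁻ x ∈ i ∷ is) → ¬ to⁻ x ≡ i → to⁻ x ∈ is
      rest (here e)  ne = contradiction e ne
      rest (there e) ne = e
      has : ∀ T → All (λ x → to⁻ x ∈ i ∷ is) T → m ℕ.+ B ≤ length T → HasIdempotent T
      has T T∈ le with m ℕ.≤? length (filter class? T)
      ... | yes m≤ = take m T₁ , ⊆-trans (Sublist.take-⊆ m T₁) (Sublist.filter-⊆ class? T) ,
                     subst (1 ≤_) (≡.sym len) 1≤m , idempotent-resp (sym prod≈) idem
        where
        T₁ = filter class? T
        len : length (take m T₁) ≡ m
        len = ≡.trans (length-take m T₁) (ℕ.m≤n⇒m⊓n≡m m≤)
        prod≈ : prod (take m T₁) ≈ m ⋆ to i
        prod≈ = trans
          (prod-constant (take m T₁) (All.take⁺ m (All.map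
            (λ { ≡.refl → sym (to∘to⁻ _) }) (All.all-filter class? T))))
          (⋆-congˡ len)
      ... | no m≰ = hasIdempotent-mono (Sublist.filter-⊆ (¬? ∘ class?) T)
          (un T₂ (All.zipWith (λ (h , ne) → rest h ne)
                   (All.filter⁺ (¬? ∘ class?) T∈ , All.all-filter (¬? ∘ class?) T)) B≤)
        where
        T₂ = filter (¬? ∘ class?) T
        B≤ : B ≤ length T₂
        B≤ = ℕ.+-cancelˡ-≤ m _ _ (ℕ.≤-trans (subst (m ℕ.+ B ≤_) (length-filter-¬ class? T) le)
               (ℕ.+-monoˡ-≤ (length T₂) (ℕ.<⇒≤ (ℕ.≰⇒> m≰))))

    module _ (_≟_ : Decidable _≈_) where

      hasIdempotent? : U.Decidable HasIdempotent
      hasIdempotent? = anySublist? λ T → (0 ℕ.<? length T) ×-dec ((prod T ∙ prod T) ≟ prod T)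

      -- Reduces the search to lists of codes in `Fin N`, of which there are finitely many of each
      -- length: coding and decoding changes each term only up to `≈`.
      hasIdempotent-to : ∀ T → HasIdempotent (map to (map to⁻ T)) → HasIdempotent T
      hasIdempotent-to T (T′ , s , ne , idem)
        with is , s , ≡.refl ← ⊆-map⁻ to (map to⁻ T) s
        with T″ , s , ≡.refl ← ⊆-map⁻ to⁻ T s
        = T″ , s
        , subst (0 <_) (≡.trans (length-map to (map to⁻ T″)) (length-map to⁻ T″)) ne
        , idempotent-resp (to∘to⁻-prod T″) idem
        where
        to∘to⁻-prod : ∀ T → prod (map to (map to⁻ T)) ≈ prod T
        to∘to⁻-prod []      = refl
        to∘to⁻-prod (x ∷ T) = ∙-cong (to∘to⁻ x) (to∘to⁻-prod T)

      -- Descent from a known bound. If some sequence of length `B` avoids idempotents, then `suc B`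
      -- is least; otherwise `B` is unavoidable too, since longer sequences can be truncated to
      -- length `B`. The descent stops before 0 because of the empty sequence.
      least-below : ∀ B → Unavoidable B → ∃ IsLeastUnavoidable
      least-below zero un with [] , [] , () , _ ← un [] z≤n
      least-below (suc B) un
        with anyList? (λ v → ¬? (hasIdempotent? (map to v))) B
      ... | yes (v , ≡.refl , ¬h) = suc (length v) , un , map to v , cong suc (≡.sym (length-map to v)) , ¬h
      ... | no ¬∃ = least-below B λ T le → hasIdempotent-mono (Sublist.take-⊆ B T)
          (hasIdempotent-to (take B T) (decidable-stable (hasIdempotent? _) λ ¬h →
            ¬∃ (map to⁻ (take B T)
               , ≡.trans (length-map to⁻ (take B T))
                   (≡.trans (length-take B T) (ℕ.m≤n⇒m⊓n≡m le))
               , ¬h)))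

      leastUnavoidable : ∃ IsLeastUnavoidable
      leastUnavoidable with B , un ← unavoidable-within (allFin N) =
        least-below B λ T → un T (All.universal (λ x → ∈-allFin (to⁻ x)) T)

-- Davenport constants and groups of units

module _ (G : AbelianGroup c ℓ) where
  open AbelianGroup G
  open GroupProperties group using (∙-cancelˡ)

  idempotent⇒ε : ∀ {x} → Idempotent commutativeMonoid x → x ≈ ε
  idempotent⇒ε {x} idem = ∙-cancelˡ x x ε (trans idem (sym (identityʳ x)))

  leastUnavoidable⇒Davenport :
    ∀ {d} → IsLeastUnavoidable commutativeMonoid d → IsDavenportConstant G d
  leastUnavoidable⇒Davenport (un , T , ≡.refl , ¬h) =
    s≤s z≤n , identityProduct , least
    where
    identityProduct : IdentityProductFrom G (suc (length T))
    identityProduct T₁ le with x ∷ xs , s , _ , idem ← un T₁ le =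
      x ∷ xs , s , trans (foldr₁≈prod commutativeMonoid x xs) (idempotent⇒ε idem)
    least : ∀ m → 1 ≤ m → IdentityProductFrom G m → suc (length T) ≤ m
    least m _ h = ℕ.≰⇒> λ m≤ → ¬h (has (h T m≤))
      where
      has : ∃[ T′ ] toList T′ ⊆ T × foldr₁ _∙_ T′ ≈ ε → HasIdempotent commutativeMonoid T
      has (x ∷ xs , s , e) = hasIdentity⇒hasIdempotent commutativeMonoid
        (x ∷ xs , s , s≤s z≤n , trans (sym (foldr₁≈prod commutativeMonoid x xs)) e)

module _ (M : CommutativeMonoid c ℓ) where
  open CommutativeMonoid M
  open Definitions _≈_ using (Invertible)
  private module G = AbelianGroup (unitGroup M)

  prod-proj₁ : ∀ T → proj₁ (prod G.commutativeMonoid T) ≡ prod M (map proj₁ T)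
  prod-proj₁ []      = ≡.refl
  prod-proj₁ (u ∷ T) = cong (proj₁ u ∙_) (prod-proj₁ T)

  toUnits : ∀ {T} → All (Invertible ε _∙_) T → ∃ λ (V : List G.Carrier) → map proj₁ V ≡ T
  toUnits []        = [] , ≡.refl
  toUnits (u ∷ us) with V , ≡.refl ← toUnits us = (_ , u) ∷ V , ≡.refl

  -- Idempotents of the unit group are trivial, so the product found is the identity. The case of
  -- distinct primes relies on this stronger conclusion.
  unavoidable-units : ∀ {d} → Unavoidable G.commutativeMonoid d →
    ∀ T → All (Invertible ε _∙_) T → d ≤ length T → HasIdentity M T
  unavoidable-units {d} un T inv le with V , ≡.refl ← toUnits inv
    with V′ , s , 0<len , idem ← un V (subst (d ≤_) (length-map proj₁ V) le) =
    map proj₁ V′ , Sublist.map⁺ proj₁ s , subst (0 <_) (≡.sym (length-map proj₁ V′)) 0<len ,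
    trans (reflexive (≡.sym (prod-proj₁ V′)))
      (idempotent⇒ε (unitGroup M) {x = prod G.commutativeMonoid V′} idem)

  module _ {N : ℕ} (finite : Finite setoid N) (_≟_ : Decidable _≈_) where
    open Surjection finite using (to; to⁻; to∘to⁻)

    invertible? : U.Decidable (Invertible ε _∙_)
    invertible? x = map′ (λ (i , e) → to i , e , trans (comm x (to i)) e)
      (λ (y , e , _) → to⁻ y , trans (∙-congʳ (to∘to⁻ y)) e)
      (Fin.any? λ i → (to i ∙ x) ≟ ε)

    toUnit : Carrier → G.Carrier
    toUnit x with invertible? x
    ... | yes inv = x , inv
    -- Non-units go to the identity, so that the enumeration of the monoid also enumerates its
    -- units.
    ... | no  _   = G.ε

    toUnit-proj₁ : ∀ x → Invertible ε _∙_ x → proj₁ (toUnit x) ≈ x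
    toUnit-proj₁ x inv with invertible? x
    ... | yes _    = refl
    ... | no ¬inv = contradiction inv ¬inv

    finiteUnits : Finite G.setoid N
    finiteUnits = record
      { to = toUnit ∘ to
      ; cong = λ { ≡.refl → refl }
      ; surjective = λ (x , y , e , e′) → to⁻ x , λ { ≡.refl →
          trans (toUnit-proj₁ (to (to⁻ x))
                  (y , trans (∙-congˡ (to∘to⁻ x)) e , trans (∙-congʳ (to∘to⁻ x)) e′))
                (to∘to⁻ x) }
      }

    leastUnavoidableUnits : ∃ (IsLeastUnavoidable G.commutativeMonoid)
    leastUnavoidableUnits =
      leastUnavoidable G.commutativeMonoid finiteUnits (λ u v → proj₁ u ≟ proj₁ v)

-- Ideals

module IdealTheory (A : CommutativeRing c ℓ) where
  open CommutativeRing A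
  open RingProperties ring
    using (-1*x≈-x; -0#≈0#; x[y-z]≈xy-xz; x≈y⇒x∙y⁻¹≈ε; //-rightDividesˡ; //-rightDividesʳ)
  open AbelianGroupProperties +-abelianGroup using (⁻¹-∙-comm)
  open CommutativeSemigroupProperties *-commutativeSemigroup using (x∙yz≈y∙xz)
  open Exp semiring using () renaming (_^_ to _↑_)
  open Divisibility *-commutativeSemigroup using (_∣_; _,_; ∙-cong-∣)
  open SetoidReasoning setoid

  Π : List Carrier → Carrier
  Π = prod *-commutativeMonoid

  x-0≈x : ∀ x → x - 0# ≈ x
  x-0≈x x = trans (+-congˡ -0#≈0#) (+-identityʳ x)

  infix 4 _≡_[mod_]
  _≡_[mod_] : Carrier → Carrier → Ideal A → Set (c ⊔ ℓ)
  x ≡ y [mod I ] = _≈_mod A I x y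

  module / (I : Ideal A) where
    open CommutativeRing (quotientRing A I) public
      using (*-commutativeMonoid)
      renaming (refl to ≡-refl; sym to ≡-sym; trans to ≡-trans;
                *-comm to ≡-*-comm; *-cong to ≡-*-cong)

    open MonoidMult (CommutativeRing.*-monoid (quotientRing A I)) public
      using () renaming (_×_ to _⋆_)

    ∈⇒≡0 : ∀ {x} → Member I x → x ≡ 0# [mod I ]
    ∈⇒≡0 {x} x∈ = congruent (Ideal.respects I (sym (x-0≈x x)) x∈)

    ≡0⇒∈ : ∀ {x} → x ≡ 0# [mod I ] → Member I x
    ≡0⇒∈ {x} (congruent d) = Ideal.respects I (x-0≈x x) d

    ∈-resp-≡ : ∀ {x y} → x ≡ y [mod I ] → Member I x → Member I y
    ∈-resp-≡ e x∈ = ≡0⇒∈ (≡-trans (≡-sym e) (∈⇒≡0 x∈))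

    *-closedʳ : ∀ {x} y → Member I x → Member I (x * y)
    *-closedʳ {x} y x∈ = Ideal.respects I (*-comm y x) (Ideal.*-closed I y x∈)

    ≈⇒≡ : ∀ {x y} → x ≈ y → x ≡ y [mod I ]
    ≈⇒≡ e = congruent (Ideal.respects I (sym (x≈y⇒x∙y⁻¹≈ε e)) (Ideal.0∈ I))

    Idem : Carrier → Set _
    Idem = Idempotent (CommutativeRing.*-commutativeMonoid (quotientRing A I))

    ∈⇒Idem : ∀ {x} → Member I x → Idem x
    ∈⇒Idem x∈ = ≡-trans (∈⇒≡0 (Ideal.*-closed I _ x∈)) (≡-sym (∈⇒≡0 x∈))

  private variable
    I J K P : Ideal A
    x y g h : Carrier

  +-∈⁻ : (I : Ideal A) → Member I x → Member I (x + y) → Member I y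
  +-∈⁻ {x} {y} I x∈ x+y∈ = Ideal.respects I eq (Ideal.+-closed I x+y∈ (Ideal.*-closed I (- 1#) x∈))
    where
    eq : (x + y) + - 1# * x ≈ y
    eq = trans (+-cong (+-comm x y) (-1*x≈-x x)) (//-rightDividesʳ x y)

  ·-⊆ˡ : ProductMember I J x → Member I x
  ·-⊆ˡ {I = I} (product {x} {y} x∈ _) = /.*-closedʳ I y x∈
  ·-⊆ˡ {I = I} 0-sum         = Ideal.0∈ I
  ·-⊆ˡ {I = I} (+-sum s t)   = Ideal.+-closed I (·-⊆ˡ s) (·-⊆ˡ t)
  ·-⊆ˡ {I = I} (≈-sum e s)   = Ideal.respects I e (·-⊆ˡ s)

  ·-⊆ʳ : ProductMember I J x → Member J x
  ·-⊆ʳ {J = J} (product {x} _ y∈) = Ideal.*-closed J x y∈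
  ·-⊆ʳ {J = J} 0-sum         = Ideal.0∈ J
  ·-⊆ʳ {J = J} (+-sum s t)   = Ideal.+-closed J (·-⊆ʳ s) (·-⊆ʳ t)
  ·-⊆ʳ {J = J} (≈-sum e s)   = Ideal.respects J e (·-⊆ʳ s)

  ^-⊆ : ∀ {n} → 1 ≤ n → Member (I ^ n) x → Member I x
  ^-⊆ (s≤s _) = ·-⊆ˡ

  ∏-⊆ : ∀ {r} (I : Fin r → Ideal A) i → Member (∏ I) x → Member (I i) x
  ∏-⊆ I Fin.zero    x∈ = ·-⊆ˡ x∈
  ∏-⊆ I (Fin.suc i) x∈ = ∏-⊆ (I ∘ Fin.suc) i (·-⊆ʳ x∈)

  Π-power : ∀ {P} n L → All (Member P) L → n ≤ length L → Member (P ^ n) (Π L)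
  Π-power zero    L       L∈ _ = tt
  Π-power {P} (suc n) (x ∷ L) (x∈ ∷ L∈) (s≤s le) =
    product {R = A} {I = P} {J = P ^ n} x∈ (Π-power n L L∈ le)

  -- Oriented so that the witness is `1# - b * x` in `I`, the form in which two witnesses are
  -- multiplied in `inverseMod-·`.
  InverseMod : Ideal A → Carrier → Set (c ⊔ ℓ)
  InverseMod I x = ∃[ b ] 1# ≡ b * x [mod I ]

  -- (1 - bx)(1 - cx) = 1 - (b + (1 - bx)c)x
  inverseMod-· : InverseMod I x → InverseMod J x → InverseMod (I · J) x
  inverseMod-· {x = x} (b , congruent u∈) (d , congruent v∈) =
    b + u * d , congruent (≈-sum eq (product u∈ v∈))
    where
    u = 1# - b * x
    eq : u * (1# - d * x) ≈ 1# - (b + u * d) * x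
    eq = begin
      u * (1# - d * x)                     ≈⟨ x[y-z]≈xy-xz u 1# (d * x) ⟩
      u * 1# - u * (d * x)                 ≈⟨ +-congʳ (*-identityʳ u) ⟩
      (1# - b * x) - u * (d * x)           ≈⟨ +-congˡ (-‿cong (*-assoc u d x)) ⟨
      (1# - b * x) - (u * d) * x           ≈⟨ +-assoc 1# _ _ ⟩
      1# + (- (b * x) - (u * d) * x)       ≈⟨ +-congˡ (⁻¹-∙-comm _ _) ⟩
      1# - (b * x + (u * d) * x)           ≈⟨ +-congˡ (-‿cong (distribʳ x b _)) ⟨
      1# - (b + u * d) * x                 ∎

  inverseMod-unitIdeal : ∀ x → InverseMod unitIdeal x
  inverseMod-unitIdeal x = 0# , congruent tt

  inverseMod-^ : ∀ n → InverseMod I x → InverseMod (I ^ n) x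
  inverseMod-^ zero    inv = inverseMod-unitIdeal _
  inverseMod-^ (suc n) inv = inverseMod-· inv (inverseMod-^ n inv)

  inverseMod-∏ : ∀ {r} (I : Fin r → Ideal A) → (∀ i → InverseMod (I i) x) → InverseMod (∏ I) x
  inverseMod-∏ {r = zero}  I inv = inverseMod-unitIdeal _
  inverseMod-∏ {r = suc r} I inv =
    inverseMod-· (inv Fin.zero) (inverseMod-∏ (I ∘ Fin.suc) (inv ∘ Fin.suc))

  inverseMod⇒∉ : ¬ Member P 1# → InverseMod P x → ¬ Member P x
  inverseMod⇒∉ {P = P} 1∉ (b , e) x∈ =
    1∉ (/.∈-resp-≡ P (/.≡-sym P e) (Ideal.*-closed P b x∈))

  -- x = x(1 - bt) + (bt)x.
  comaximal⇒· : ∀ {t} → Member I t → InverseMod J t → Member I x → Member J x → Member (I · J) x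
  comaximal⇒· {I = I} {x = x} {t = t} t∈ (b , congruent u∈) x∈I x∈J =
    ≈-sum eq (+-sum (product x∈I u∈) (product (Ideal.*-closed I b t∈) x∈J))
    where
    eq : x * (1# - b * t) + (b * t) * x ≈ x
    eq = begin
      x * (1# - b * t) + (b * t) * x     ≈⟨ +-congˡ (*-comm _ x) ⟩
      x * (1# - b * t) + x * (b * t)     ≈⟨ distribˡ x _ _ ⟨
      x * ((1# - b * t) + b * t)         ≈⟨ *-congˡ (//-rightDividesˡ (b * t) 1#) ⟩
      x * 1#                             ≈⟨ *-identityʳ x ⟩
      x                                  ∎

  -- The Chinese remainder argument: an intersection of pairwise comaximal ideals lies in their
  -- product. The element `t` of the first ideal is invertible modulo each other ideal, hence modulo
  -- their product, so `comaximal⇒·` splits off the first ideal.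
  comaximal⇒∏ : ∀ {r} (I : Fin r → Ideal A) (t : Fin r → Carrier) → (∀ i → Member (I i) (t i)) →
                (∀ i j → i ≢ j → InverseMod (I j) (t i)) →
                (∀ i → Member (I i) x) → Member (∏ I) x
  comaximal⇒∏ {r = zero}  I t t∈ inv x∈ = tt
  comaximal⇒∏ {r = suc r} I t t∈ inv x∈ =
    comaximal⇒· (t∈ Fin.zero)
      (inverseMod-∏ (I ∘ Fin.suc) (λ j → inv Fin.zero (Fin.suc j) λ ()))
      (x∈ Fin.zero)
      (comaximal⇒∏ (I ∘ Fin.suc) (t ∘ Fin.suc) (t∈ ∘ Fin.suc)
        (λ i j i≢j → inv (Fin.suc i) (Fin.suc j) (i≢j ∘ Fin.suc-injective)) (x∈ ∘ Fin.suc))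

  x[x-1]≈xx-x : ∀ x → x * (x - 1#) ≈ x * x - x
  x[x-1]≈xx-x x = trans (x[y-z]≈xy-xz x x 1#) (+-congˡ (-‿cong (*-identityʳ x)))

  module _ (prime : IsPrimeIdeal P) where
    open IsPrimeIdeal prime using (proper) renaming (prime to prime-*)

    ∉-* : ¬ Member P x → ¬ Member P y → ¬ Member P (x * y)
    ∉-* x∉ y∉ xy∈ = [ x∉ , y∉ ]′ (prime-* _ _ xy∈)

    -- Powers in the quotient by `K` are computed on representatives by the ring multiplication, so
    -- primality of `P` applies to them directly.
    power-∈⁻ : ∀ n → Member P (/._⋆_ K n x) → Member P x
    power-∈⁻     zero    1∈ = contradiction 1∈ proper
    power-∈⁻ {K} (suc n) x∈ = [ id , power-∈⁻ {K} n ]′ (prime-* _ _ x∈)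

    -- An idempotent power e of x modulo K has e(e - 1) ∈ P.
    prime-dichotomy : (∀ {x} → Member K x → Member P x) → ∀ x →
      ∃[ m ] 1 ≤ m × /.Idem K (/._⋆_ K m x) → Member P x ⊎ InverseMod P x
    prime-dichotomy {K} K⊆P x (suc k , _ , congruent d)
      with prime-* e (e - 1#) (Ideal.respects P (sym (x[x-1]≈xx-x e)) (K⊆P d))
      where e = /._⋆_ K (suc k) x
    ... | inj₁ e∈   = inj₁ (power-∈⁻ {K} (suc k) e∈)
    -- The exponent being positive, `e` is `x` times its `k`-th power; as `e` is 1 modulo `P`, that
    -- power is the inverse.
    ... | inj₂ e-1∈ = inj₂ (/._⋆_ K k x ,
            /.≡-trans P (/.≡-sym P (congruent e-1∈)) (/.≡-*-comm P x _))

  -- Generators and valuations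

  Generates : Carrier → Ideal A → Set (c ⊔ ℓ)
  Generates g I = Member I g × (∀ {x} → Member I x → g ∣ x)

  generates-unitIdeal : Generates 1# unitIdeal
  generates-unitIdeal = tt , λ {x} _ → x , *-identityʳ x

  generates-· : Generates g I → Generates h J → Generates (g * h) (I · J)
  generates-· {g} {I} {h} {J} (g∈ , g∣) (h∈ , h∣) = product g∈ h∈ , gh∣
    where
    gh∣ : Member (I · J) x → g * h ∣ x
    gh∣ (product x∈ y∈) = ∙-cong-∣ (g∣ x∈) (h∣ y∈)
    gh∣ 0-sum           = 0# , zeroˡ _
    gh∣ (+-sum s t) with q , e ← gh∣ s | q′ , e′ ← gh∣ t =
      q + q′ , trans (distribʳ _ q q′) (+-cong e e′)
    gh∣ (≈-sum e s) with q , e′ ← gh∣ s = q , trans e′ e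

  generates-^ : ∀ n → Generates g I → Generates (g ↑ n) (I ^ n)
  generates-^ zero    _   = generates-unitIdeal
  generates-^ (suc n) gen = generates-· gen (generates-^ n gen)

  generates-∏ : ∀ {r} (g : Fin r → Carrier) (I : Fin r → Ideal A) →
                (∀ i → Generates (g i) (I i)) → Generates (Vector.foldr _*_ 1# g) (∏ I)
  generates-∏ {r = zero}  g I gen = generates-unitIdeal
  generates-∏ {r = suc r} g I gen =
    generates-· (gen Fin.zero) (generates-∏ (g ∘ Fin.suc) (I ∘ Fin.suc) (gen ∘ Fin.suc))

  ∣⇒∈ : Member I g → g ∣ x → Member I x
  ∣⇒∈ {I = I} g∈ (q , e) = Ideal.respects I e (Ideal.*-closed I q g∈)

  Cancellable : Carrier → Set _
  Cancellable x = ∀ y z → x * y ≈ x * z → y ≈ z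

  ↑-∣-cancel : Cancellable g → ∀ m n → g ↑ (m ℕ.+ n) ∣ g ↑ m * x → g ↑ n ∣ x
  ↑-∣-cancel cancel zero    n (q , e) = q , trans e (*-identityˡ _)
  ↑-∣-cancel cancel (suc m) n (q , e) = ↑-∣-cancel cancel m n
    (q , cancel _ _ (trans (x∙yz≈y∙xz _ q _) (trans e (*-assoc _ _ _))))

  module _ (prime : IsPrimeIdeal P) (P? : U.Decidable (Member P)) where
    open IsPrimeIdeal prime using (proper)

    -- Every term in `P` is the generator itself and contributes exactly one factor `g`; the
    -- remaining terms multiply to an element outside `P` by primality.
    Π-valuation : ∀ L → All (λ x → Member P x → x ≈ g) L →
                  ∃[ w ] ¬ Member P w × Π L ≈ g ↑ length (filter P? L) * w
    Π-valuation []      []       = 1# , proper , sym (*-identityˡ 1#)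
    Π-valuation (x ∷ L) (h ∷ hs) with w , w∉ , e ← Π-valuation L hs | P? x
    ... | yes x∈ = w , w∉ , trans (*-cong (h x∈) e) (sym (*-assoc _ _ w))
    ... | no  x∉ = x * w , ∉-* prime x∉ w∉ , trans (*-congˡ e) (x∙yz≈y∙xz x _ w)

    -- If c ≥ 1 then e - 1 ∉ P, while cancelling gᶜ from gⁿ ∣ gᶜ w (e - 1) leaves g ∣ w (e - 1).
    idempotent-valuation : Generates g P → Cancellable g → ∀ {e w n} c → c < n →
      ¬ Member P w → e ≈ g ↑ c * w → /.Idem (P ^ n) e → c ≡.≡ 0
    idempotent-valuation gen cancel zero _ _ _ _ = ≡.refl
    idempotent-valuation {g} gen cancel {e} {w} {n} (suc c) c<n w∉ e≈ (congruent d) =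
      contradiction w[e-1]∈ (∉-* prime w∉ e-1∉)
      where
      -- The strict bound `suc c < n` leaves exponent `suc k`, at least 1, after `g ↑ suc c` is
      -- cancelled.
      k = n ∸ suc (suc c)
      n≡ : n ≡.≡ suc c ℕ.+ suc k
      n≡ = ≡.sym (≡.trans (ℕ.+-suc (suc c) k) (ℕ.m+[n∸m]≡n c<n))
      e∈ : Member P e
      e∈ = Ideal.respects P (sym e≈) (/.*-closedʳ P w (/.*-closedʳ P (g ↑ c) (proj₁ gen)))
      e-1∉ : ¬ Member P (e - 1#)
      e-1∉ e-1∈ = proper (/.∈-resp-≡ P (congruent e-1∈) e∈)
      divides : g ↑ (suc c ℕ.+ suc k) ∣ g ↑ suc c * (w * (e - 1#))
      divides with q , eq ← proj₂ (generates-^ n gen) d =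
        q , (begin
          q * g ↑ (suc c ℕ.+ suc k)          ≡⟨ cong (λ m → q * g ↑ m) (≡.sym n≡) ⟩
          q * g ↑ n                          ≈⟨ eq ⟩
          e * e - e                          ≈⟨ x[x-1]≈xx-x e ⟨
          e * (e - 1#)                       ≈⟨ *-congʳ e≈ ⟩
          g ↑ suc c * w * (e - 1#)           ≈⟨ *-assoc _ w _ ⟩
          g ↑ suc c * (w * (e - 1#))         ∎)
      w[e-1]∈ : Member P (w * (e - 1#))
      w[e-1]∈ = ∣⇒∈ {I = P} (/.*-closedʳ P (g ↑ k) (proj₁ gen))
        (↑-∣-cancel cancel (suc c) (suc k) divides)

  ∈-· : ∀ {I : Ideal A} {x} → Member I x → Member (I · unitIdeal) x
  ∈-· {I} x∈ = ≈-sum (*-identityʳ _) (product {R = A} {I = I} {J = unitIdeal} x∈ tt)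

  -- Stated for a free `r`, so that `r ≡ 1` can be matched; with `r` a field of a given
  -- factorization it cannot.
  single-factor : ∀ {r} (I : Fin r → Ideal A) (n : Fin r → ℕ) → r ≡ 1 →
    ∃[ i ] (∀ j → j ≡ i) × (∀ {x} → Member (I i) x → Member (∏ I) x) ×
           Vector.foldr ℕ._+_ 0 n ≡ n i
  single-factor I n ≡.refl =
    Fin.zero , (λ { Fin.zero → ≡.refl }) , (λ x∈ → ∈-· x∈) , ℕ.+-identityʳ _

  vprod : ∀ {r} → (Fin r → Carrier) → Carrier
  vprod = Vector.foldr _*_ 1#

  vprod-∈ : ∀ {r} (I : Ideal A) (f : Fin r → Carrier) i → Member I (f i) → Member I (vprod f)
  vprod-∈ I f Fin.zero    f∈ = /.*-closedʳ I _ f∈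
  vprod-∈ I f (Fin.suc i) f∈ = Ideal.*-closed I _ (vprod-∈ I (f ∘ Fin.suc) i f∈)

  vprod-∉ : ∀ {r} {P : Ideal A} → IsPrimeIdeal P → (f : Fin r → Carrier) →
            (∀ i → ¬ Member P (f i)) → ¬ Member P (vprod f)
  vprod-∉ {zero}  prime f f∉ = IsPrimeIdeal.proper prime
  vprod-∉ {suc r} prime f f∉ =
    ∉-* prime (f∉ Fin.zero) (vprod-∉ prime (f ∘ Fin.suc) (f∉ ∘ Fin.suc))

  generator≉0 : ∀ {I g} → IsNonzeroIdeal I → Generates g I → ¬ g ≈ 0#
  generator≉0 (f , f∈ , f≉0) (_ , g∣) g≈0 with q , e ← g∣ f∈ =
    f≉0 (trans (sym e) (trans (*-congˡ g≈0) (zeroʳ q)))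

-- All that is used of F[x] when K is nonzero.
record FiniteQuotientPID (A : CommutativeRing c ℓ) : Set (lsuc (c ⊔ ℓ)) where
  open CommutativeRing A
  open IdealTheory A
  open Divisibility *-commutativeSemigroup using (_∣_)
  field
    cancellable    : ∀ {x} → ¬ x ≈ 0# → Cancellable x
    _∣?_           : ∀ {x} → ¬ x ≈ 0# → ∀ y → Dec (x ∣ y)
    principal      : ∀ I → U.Decidable (Member I) → IsNonzeroIdeal I → ∃[ g ] Generates g I
    finiteQuotient : ∀ I → IsNonzeroIdeal I →
                     ∃[ N ] Finite (CommutativeRing.setoid (quotientRing A I)) N

-- The two bounds for a nonzero ideal

module ErdősBurgess {A : CommutativeRing c ℓ} (pid : FiniteQuotientPID A)
                    (K : Ideal A) (nonzero : IsNonzeroIdeal K) (φ : Factorization K) where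
  open CommutativeRing A
  open IdealTheory A
  open FiniteQuotientPID pid
  open Exp semiring using () renaming (_^_ to _↑_)
  open Definitions using (Invertible)
  open Factorization φ

  private
    R = quotientRing A K
    S = CommutativeRing.*-commutativeMonoid R
    open module G = AbelianGroup (units R) using () renaming (commutativeMonoid to Uᴹ)

    K⊆P^n : ∀ i {x} → Member K x → Member (P i ^ n i) x
    K⊆P^n i x∈ = ∏-⊆ (λ i → P i ^ n i) i (proj₁ factors x∈)

    K⊆P : ∀ i {x} → Member K x → Member (P i) x
    K⊆P i x∈ = ^-⊆ {I = P i} (n≥1 i) (K⊆P^n i x∈)

    nonzeroP : ∀ i → IsNonzeroIdeal (P i)
    nonzeroP i = proj₁ nonzero , K⊆P i (proj₁ (proj₂ nonzero)) , proj₂ (proj₂ nonzero)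

    finiteR : Finite (CommutativeMonoid.setoid S) (proj₁ (finiteQuotient K nonzero))
    finiteR = proj₂ (finiteQuotient K nonzero)

    inverse⇒∉ : ∀ i {x} → InverseMod (P i) x → ¬ Member (P i) x
    inverse⇒∉ i = inverseMod⇒∉ {P = P i} (IsPrimeIdeal.proper (P-prime i))

    -- Left transparent, these searches get unfolded by every later with-abstraction.
    abstract
      dichotomy : ∀ i x → Member (P i) x ⊎ InverseMod (P i) x
      dichotomy i x = prime-dichotomy (P-prime i) {K = K} (K⊆P i) x (idempotentPower S finiteR x)

      P? : ∀ i → U.Decidable (Member (P i))
      P? i x = [ yes , no ∘ inverse⇒∉ i ]′ (dichotomy i x)

      ∉⇒inverse : ∀ i x → ¬ Member (P i) x → InverseMod (P i) x
      ∉⇒inverse i x x∉ = [ (λ x∈ → contradiction x∈ x∉) , id ]′ (dichotomy i x)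

      p : Fin r → Carrier
      p i = proj₁ (principal (P i) (P? i) (nonzeroP i))

      p-generates : ∀ i → Generates (p i) (P i)
      p-generates i = proj₂ (principal (P i) (P? i) (nonzeroP i))

    p∈ : ∀ i → Member (P i) (p i)
    p∈ i = proj₁ (p-generates i)

    -- p j ∈ P i would give P j ⊆ P i, hence P j = P i as P j is maximal.
    p∉ : ∀ i j → j ≢ i → ¬ Member (P i) (p j)
    p∉ i j j≢i pj∈ = P-distinct j i j≢i (Pj⊆Pi , Pi⊆Pj)
      where
      Pj⊆Pi : ∀ {x} → Member (P j) x → Member (P i) x
      Pj⊆Pi x∈ = ∣⇒∈ {I = P i} pj∈ (proj₂ (p-generates j) x∈)
      Pi⊆Pj : ∀ {x} → Member (P i) x → Member (P j) x
      Pi⊆Pj {x} x∈ = [ id , (λ (b , congruent d) →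
        contradiction x∈ (inverse⇒∉ i (b , congruent (Pj⊆Pi d)))) ]′ (dichotomy j x)

    -- A generator of `K`, which makes `K` decidable through divisibility. The order matters: the
    -- primes are decided first, by idempotent powers, which require only the finite enumeration of
    -- the quotient; this yields the `p i`, then `g`, and finally equality modulo `K`.
    g : Carrier
    g = vprod (λ i → p i ↑ n i)

    g-generates : Generates g K
    g-generates = proj₂ factors (proj₁ ∏-generates) , proj₂ ∏-generates ∘ proj₁ factors
      where
      ∏-generates : Generates g (∏ λ i → P i ^ n i)
      ∏-generates = generates-∏ (λ i → p i ↑ n i) (λ i → P i ^ n i)
        (λ i → generates-^ (n i) (p-generates i))

    abstract
      K? : U.Decidable (Member K)
      K? x = map′ (∣⇒∈ {I = K} (proj₁ g-generates)) (proj₂ g-generates)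
               (generator≉0 {I = K} nonzero g-generates ∣? x)

    _≟_ : Decidable (_≈_mod A K)
    x ≟ y = map′ congruent _≈_mod.difference (K? (x - y))

    unit⇒∉ : ∀ i (u : G.Carrier) → ¬ Member (P i) (proj₁ u)
    unit⇒∉ i (x , y , congruent d , _) =
      inverse⇒∉ i (y , /.≡-sym (P i) (congruent (K⊆P i d)))

    -- Inverses modulo the `P i` lift to the powers `P i ^ n i` and then to their product by
    -- repeated use of `inverseMod-·`.
    ∉⇒unit : ∀ x → (∀ i → ¬ Member (P i) x) → Invertible (_≈_mod A K) 1# _*_ x
    ∉⇒unit x x∉ = invertible (inverseMod-∏ (λ i → P i ^ n i)
      (λ i → inverseMod-^ (n i) (∉⇒inverse i x (x∉ i))))
      where
      invertible : InverseMod (∏ λ i → P i ^ n i) x → Invertible (_≈_mod A K) 1# _*_ x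
      invertible (b , congruent d) = b , bx≡1 , /.≡-trans K (/.≡-*-comm K x b) bx≡1
        where bx≡1 = /.≡-sym K (congruent (proj₂ factors d))

    -- The valuation of a subproduct at `P i` is the number of its terms in `P i`. Only copies of
    -- `p i` are counted, at most `n i - 1` of them, so for an idempotent `idempotent-valuation`
    -- makes the number 0. The terms then all come from `T`.
    avoiding : ∀ T → ¬ HasIdempotent Uᴹ T → ¬ HasIdempotent S (map proj₁ T ++ repeats n p)
    avoiding T ¬h (T′ , s , 0<len , idem) = ¬h′ (⊆-map⁻ proj₁ T T′⊆)
      where
      L = map proj₁ T ++ repeats n p
      equal : ∀ i → All (λ x → Member (P i) x → x ≈ p i) L
      equal i = All.++⁺ (All.map⁺ (All.universal (λ u u∈ → contradiction u∈ (unit⇒∉ i u)) T))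
                  (all-repeats n p equal-p)
        where
        equal-p : ∀ j → Member (P i) (p j) → p j ≈ p i
        equal-p j pj∈ with j Fin.≟ i
        ... | yes ≡.refl = refl
        ... | no j≢i     = contradiction pj∈ (p∉ i j j≢i)
      count : ∀ i → length (filter (P? i) L) ≡ n i ∸ 1
      count i = ≡.trans (cong length (filter-++ (P? i) (map proj₁ T) (repeats n p)))
        (≡.trans (cong (λ xs → length (xs ++ filter (P? i) (repeats n p)))
                   (filter-none (P? i) (All.map⁺ (All.universal (unit⇒∉ i) T))))
          (length-filter-repeats (P? i) n p i (p∈ i) (λ j → p∉ i j)))
      count′< : ∀ i → length (filter (P? i) T′) < n i
      count′< i = begin-strict
        length (filter (P? i) T′)   ≤⟨ Sublist.length-mono-≤
                                         (Sublist.filter⁺ (P? i) (P? i) (λ { ≡.refl → id }) s) ⟩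
        length (filter (P? i) L)    ≡⟨ count i ⟩
        n i ∸ 1                     <⟨ ℕ.≤-reflexive (ℕ.m+[n∸m]≡n (n≥1 i)) ⟩
        n i                         ∎
        where open ℕ.≤-Reasoning
      none : ∀ i → All (¬_ ∘ Member (P i)) T′
      none i with w , w∉ , e ← Π-valuation (P-prime i) (P? i) T′ (Sublist.All-resp-⊆ s (equal i)) =
        filter-empty⁻ (P? i) T′
          (idempotent-valuation (P-prime i) (P? i) (p-generates i)
            (cancellable (generator≉0 {I = P i} (nonzeroP i) (p-generates i)))
            _ (count′< i) w∉ e (congruent (K⊆P^n i (_≈_mod.difference idem))))
      -- Each `p i` fails to avoid its own prime `P i`, so no repeated generator can occur in `T′`.
      T′⊆ : T′ ⊆ map proj₁ T
      T′⊆ = ⊆-++⁻ˡ {Q = λ x → ∀ i → ¬ Member (P i) x} (map proj₁ T)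
        (All.tabulate λ x∈ i → All.lookup (none i) x∈)
        (all-repeats n p λ i h → h i (p∈ i)) s
      ¬h′ : ¬ (∃[ V ] V ⊆ T × T′ ≡ map proj₁ V)
      ¬h′ (V , V⊆ , ≡.refl) = ¬h (V , V⊆ , subst (0 <_) (length-map proj₁ V) 0<len ,
        subst (/.Idem K) (≡.sym (prod-proj₁ S V)) idem)

    -- With `b` the length of the avoiding sequence of units, `suc b` is the Davenport constant, and
    -- the claimed bound is one more than the length of the sequence in `avoiding`.
    D+Ω∸ω : ∀ b → suc b ℕ.+ Ω ∸ ω ≡ suc (b ℕ.+ length (repeats n p))
    D+Ω∸ω b = begin
      suc b ℕ.+ Ω ∸ r              ≡⟨ cong (λ k → suc b ℕ.+ k ∸ r) (length-repeats n p n≥1) ⟨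
      suc b ℕ.+ (m ℕ.+ r) ∸ r      ≡⟨ cong (_∸ r) (ℕ.+-assoc (suc b) m r) ⟨
      suc b ℕ.+ m ℕ.+ r ∸ r        ≡⟨ ℕ.m+n∸n≡m (suc b ℕ.+ m) r ⟩
      suc b ℕ.+ m                  ∎
      where
      open ≡.≡-Reasoning
      m = length (repeats n p)

    lowerBound : ∀ {i d} → IsLeastUnavoidable S i → IsLeastUnavoidable Uᴹ d → d ℕ.+ Ω ∸ ω ≤ i
    lowerBound {i} (un , _) (_ , T , ≡.refl , ¬h) = ℕ.≮⇒≥ λ i< → avoiding T ¬h (un _ (begin
      i                                      ≤⟨ ℕ.s≤s⁻¹ (subst (i <_) (D+Ω∸ω (length T)) i<) ⟩
      length T ℕ.+ m                         ≡⟨ cong (ℕ._+ m) (length-map proj₁ T) ⟨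
      length (map proj₁ T) ℕ.+ m             ≡⟨ length-++ (map proj₁ T) ⟨
      length (map proj₁ T ++ repeats n p)    ∎))
      where
      open ℕ.≤-Reasoning
      m = length (repeats n p)

    upper-power : ∀ {d} → Unavoidable Uᴹ d → IsPowerOfPrime → Unavoidable S (d ℕ.+ Ω ∸ ω)
    upper-power {d} un r≡1 T le with i , only , ⊆∏ , Ω≡ ← single-factor (λ i → P i ^ n i) n r≡1 =
      split (n i ℕ.≤? length (filter (P? i) T))
      where
      T₂ = filter (¬? ∘ P? i) T
      inv : All (Invertible (_≈_mod A K) 1# _*_) T₂
      inv = All.map (λ {x} x∉ → ∉⇒unit x λ j → subst (λ k → ¬ Member (P k) x) (≡.sym (only j)) x∉)
              (All.all-filter (¬? ∘ P? i) T)
      -- At most `n i - 1` of the at least `d + n i - 1` terms lie in the prime. The subtracted 1 is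
      -- `r`, which becomes the `suc` on the length.
      d≤ : length (filter (P? i) T) < n i → d ≤ length T₂
      d≤ T₁< = ℕ.+-cancelˡ-≤ (n i) _ _ (begin
        n i ℕ.+ d                                    ≡⟨ ℕ.+-comm (n i) d ⟩
        d ℕ.+ n i                                    ≡⟨ cong (d ℕ.+_) (≡.sym Ω≡) ⟩
        d ℕ.+ Ω                                      ≤⟨ ℕ.m≤n+m∸n (d ℕ.+ Ω) r ⟩
        r ℕ.+ (d ℕ.+ Ω ∸ r)                          ≤⟨ ℕ.+-mono-≤ (ℕ.≤-reflexive r≡1) le ⟩
        suc (length T)                               ≡⟨ cong suc (length-filter-¬ (P? i) T) ⟩
        suc (length (filter (P? i) T)) ℕ.+ length T₂ ≤⟨ ℕ.+-monoˡ-≤ (length T₂) T₁< ⟩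
        n i ℕ.+ length T₂                            ∎)
        where open ℕ.≤-Reasoning
      split : Dec (n i ≤ length (filter (P? i) T)) → HasIdempotent S T
      -- The product of all terms in `P i` lies in `K`, so it is the idempotent 0 of the quotient;
      -- `n≥1` makes this subsequence nonempty.
      split (yes n≤) = filter (P? i) T , Sublist.filter-⊆ (P? i) T , ℕ.≤-trans (n≥1 i) n≤ ,
        /.∈⇒Idem K (proj₂ factors (⊆∏ (Π-power {P i} (n i) _ (All.all-filter (P? i) T) n≤)))
      split (no n≰) = hasIdempotent-mono S (Sublist.filter-⊆ (¬? ∘ P? i) T)
        (hasIdentity⇒hasIdempotent S (unavoidable-units S un T₂ inv (d≤ (ℕ.≰⇒> n≰))))

    -- Products of distinct primes

    factor : ∀ {x} i → Dec (Member (P i) x) → Carrier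
    factor i (yes _) = 1#
    factor i (no  _) = p i

    complement : Carrier → Carrier
    complement x = vprod λ i → factor i (P? i x)

    complement-∉ : ∀ i {x} → Member (P i) x → ¬ Member (P i) (complement x)
    complement-∉ i {x} x∈ = vprod-∉ (P-prime i) _ factor∉
      where
      factor∉ : ∀ j → ¬ Member (P i) (factor j (P? j x))
      factor∉ j with P? j x
      ... | yes _ = IsPrimeIdeal.proper (P-prime i)
      -- The factor `p j` occurs only when `x` is outside `P j`, whereas `x` lies in `P i`; hence
      -- `j` differs from `i`.
      ... | no x∉ = p∉ i j λ { ≡.refl → x∉ x∈ }

    complement-∈ : ∀ i {x} → ¬ Member (P i) x → Member (P i) (complement x)
    complement-∈ i {x} x∉ = vprod-∈ (P i) _ i factor∈
      where
      factor∈ : Member (P i) (factor i (P? i x))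
      factor∈ with P? i x
      ... | yes x∈ = contradiction x∈ x∉
      ... | no _   = p∈ i

    shift : Carrier → Carrier
    shift x = x + complement x

    -- Each prime contains exactly one of `x` and `complement x`, so it cannot contain their sum.
    shift-∉ : ∀ i x → ¬ Member (P i) (shift x)
    shift-∉ i x x+z∈ with P? i x
    ... | yes x∈ = complement-∉ i x∈ (+-∈⁻ (P i) x∈ x+z∈)
    ... | no  x∉ = x∉ (+-∈⁻ (P i) (complement-∈ i x∉) (Ideal.respects (P i) (+-comm x _) x+z∈))

    shift-≡ : ∀ i {x} → ¬ Member (P i) x → shift x ≡ x [mod P i ]
    shift-≡ i {x} x∉ = congruent (Ideal.respects (P i) (sym eq) (complement-∈ i x∉))
      where
      eq : (x + complement x) - x ≈ complement x
      eq = trans (+-congʳ (+-comm x _))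
             (trans (+-assoc _ x _) (trans (+-congˡ (-‿inverseʳ x)) (+-identityʳ _)))

    Π-shift : ∀ i T → All (¬_ ∘ Member (P i)) T → Π (map shift T) ≡ Π T [mod P i ]
    Π-shift i []      []        = /.≡-refl (P i)
    Π-shift i (x ∷ T) (x∉ ∷ T∉) = /.≡-*-cong (P i) (shift-≡ i x∉) (Π-shift i T T∉)

    Π-∈ : ∀ i {T} → Any (Member (P i)) T → Member (P i) (Π T)
    Π-∈ i (here x∈)  = /.*-closedʳ (P i) _ x∈
    Π-∈ i (there x∈) = Ideal.*-closed (P i) _ (Π-∈ i x∈)

    upper-distinct : ∀ {d} → Unavoidable Uᴹ d → IsProductOfDistinctPrimes →
                     Unavoidable S (d ℕ.+ Ω ∸ ω)
    upper-distinct {d} un n≡1 T le = lift (unavoidable-units S un (map shift T)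
      (All.map⁺ (All.universal (λ x → ∉⇒unit (shift x) (λ i → shift-∉ i x)) T)) d≤)
      where
      d≤ : d ≤ length (map shift T)
      d≤ = begin
        d                        ≡⟨ ℕ.m+n∸n≡m d r ⟨
        d ℕ.+ r ∸ r              ≡⟨ cong (λ k → d ℕ.+ k ∸ r) (foldr-const-1 n n≡1) ⟨
        d ℕ.+ Ω ∸ r              ≤⟨ le ⟩
        length T                 ≡⟨ length-map shift T ⟨
        length (map shift T)     ∎
        where open ℕ.≤-Reasoning
      -- Even for `n i` equal to 1 the power is `P i · unitIdeal`, which has the members of `P i`
      -- but is a different expression.
      P⊆P^n : ∀ i {x} → Member (P i) x → Member (P i ^ n i) x
      P⊆P^n i {x} x∈ = subst (λ k → Member (P i ^ k) x) (≡.sym (n≡1 i)) (∈-· {P i} x∈)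
      idem : ∀ i T → Π (map shift T) ≡ 1# [mod K ] → /.Idem (P i) (Π T)
      idem i T e with Any.any? (P? i) T
      ... | yes some = /.∈⇒Idem (P i) (Π-∈ i some)
      ... | no  none = ≈ε⇒idempotent (/.*-commutativeMonoid (P i))
        (/.≡-trans (P i) (/.≡-sym (P i) (Π-shift i T (All.¬Any⇒All¬ T none)))
          (congruent (K⊆P i (_≈_mod.difference e))))
      lift : HasIdentity S (map shift T) → HasIdempotent S T
      lift (_ , s , 0<len , e) with T′ , s′ , ≡.refl ← ⊆-map⁻ shift T s =
        -- The difference of `Π T′ * Π T′` and `Π T′` lies in every `P i`. The `p i` witness that
        -- the primes are pairwise comaximal, so the difference lies in the product, that is, in
        -- `K`.
        T′ , s′ , subst (0 <_) (length-map shift T′) 0<len , congruent (proj₂ factors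
          (comaximal⇒∏ (λ i → P i ^ n i) p (λ i → P⊆P^n i (p∈ i))
            (λ i j i≢j → inverseMod-^ (n j) (∉⇒inverse j (p i) (p∉ j i i≢j)))
            (λ i → P⊆P^n i (_≈_mod.difference (idem i T′ e)))))

  constants : ∃[ I ] ∃[ D ]
    IsErdősBurgessConstant (multiplicativeSemigroup (quotientRing A K)) I ×
    IsDavenportConstant (units (quotientRing A K)) D ×
    [ D ℕ.+ Ω ∸ ω ] ≤⁺ I ×
    (IsPowerOfPrime ⊎ IsProductOfDistinctPrimes → I ≡ [ D ℕ.+ Ω ∸ ω ])
  constants = conclude
    (leastUnavoidable S finiteR _≟_)
    (leastUnavoidableUnits S finiteR _≟_)
    where
    conclude : ∃ (IsLeastUnavoidable S) → ∃ (IsLeastUnavoidable Uᴹ) → _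
    conclude (i , i-least) (d , d-least@(un , _)) =
      [ i ] , d ,
      leastUnavoidable⇒ErdősBurgess S i-least ,
      leastUnavoidable⇒Davenport (units R) d-least ,
      [ lowerBound i-least d-least ] ,
      λ cases → cong [_] (ℕ.≤-antisym
        (leastUnavoidable⇒≤ S i-least ([ upper-power un , upper-distinct un ]′ cases))
        (lowerBound i-least d-least))

-- Polynomials over a finite field

least : {P : ℕ → Set b} → U.Decidable P → ∀ {n} → P n →
        ∃[ m ] P m × (∀ {k} → k < m → ¬ P k)
least {P = P} P? {n} Pn =
  [ id , (λ none → contradiction Pn (none (ℕ.n<1+n n))) ]′ (search (suc n))
  where
  search : ∀ n → (∃[ m ] P m × (∀ {k} → k < m → ¬ P k)) ⊎ (∀ {k} → k < n → ¬ P k)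
  search zero = inj₂ λ ()
  search (suc n) with search n
  ... | inj₁ found = inj₁ found
  ... | inj₂ none with P? n
  ...   | yes Pn = inj₁ (n , Pn , none)
  ...   | no ¬Pn = inj₂ λ k<1+n → [ none , (λ { ≡.refl → ¬Pn }) ]′ (ℕ.m≤n⇒m<n∨m≡n (ℕ.s≤s⁻¹ k<1+n))

module Polynomials {q : ℕ} (F : FiniteField c ℓ q) where
  open FiniteField F using (0≉1; invertible; cardinality) renaming (commutativeRing to k)
  open CommutativeRing k
  open SetoidReasoning setoid
  private
    module A = CommutativeRing (F [x])
    module Aᴾ = RingProperties A.ring
    module kᴾ = RingProperties ring
    module Card = Inverse cardinality
  open IdealTheory (F [x])
  open Divisibility A.*-commutativeSemigroup using (_∣_; _,_)

  infix 4 _≟_ _≋_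
  _≟_ : Decidable _≈_
  x ≟ y = map′ (λ e → trans (sym (Card.strictlyInverseʳ x)) (trans (Card.from-cong e) (Card.strictlyInverseʳ y)))
            Card.to-cong (Card.to x Fin.≟ Card.to y)

  _≋_ = _≈ₚ_ k

  coe : List Carrier → ℕ → Carrier
  coe = coeff k

  -- Trailing zeros are allowed, so the degree is read from the coefficients and not from the
  -- length. The zero polynomial has none.
  record HasDegree (p : List Carrier) (n : ℕ) : Set ℓ where
    constructor _,_
    field
      leading≉0 : ¬ coe p n ≈ 0#
      above≈0   : ∀ {m} → n < m → coe p m ≈ 0#

  -- Also true of the zero polynomial, as remainders require.
  DegreeBelow : List Carrier → ℕ → Set ℓ
  DegreeBelow p n = ∀ {m} → n ≤ m → coe p m ≈ 0#

  *-≉0 : ∀ {x y} → ¬ x ≈ 0# → ¬ y ≈ 0# → ¬ x * y ≈ 0#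
  *-≉0 {x} {y} x≉0 y≉0 xy≈0 with x′ , x′x≈1 , _ ← invertible x x≉0 = y≉0 (begin
    y             ≈⟨ *-identityˡ y ⟨
    1# * y        ≈⟨ *-congʳ x′x≈1 ⟨
    x′ * x * y    ≈⟨ *-assoc x′ x y ⟩
    x′ * (x * y)  ≈⟨ *-congˡ xy≈0 ⟩
    x′ * 0#       ≈⟨ zeroʳ x′ ⟩
    0#            ∎)

  zeroOrDegree : ∀ p → p ≋ [] ⊎ ∃ (HasDegree p)
  zeroOrDegree [] = inj₁ A.refl
  zeroOrDegree (a ∷ p) with zeroOrDegree p | a ≟ 0#
  ... | inj₂ (n , lead , above) | _       = inj₂ (suc n , lead , λ { (s≤s n<m) → above n<m })
  ... | inj₁ p≈0                | yes a≈0 = inj₁ (coeffwise λ { zero → a≈0 ; (suc m) → coeff≈ p≈0 m })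
  ... | inj₁ p≈0                | no a≉0  = inj₂ (0 , a≉0 , λ { {suc m} _ → coeff≈ p≈0 m })

  degree : ∀ {p} → ¬ p ≋ [] → ∃ (HasDegree p)
  degree {p} p≉0 with zeroOrDegree p
  ... | inj₁ p≈0 = contradiction p≈0 p≉0
  ... | inj₂ deg = deg

  hasDegree-resp : ∀ {p p′ n} → p ≋ p′ → HasDegree p n → HasDegree p′ n
  hasDegree-resp e (lead , above) =
    (λ z → lead (trans (coeff≈ e _) z)) , λ n<m → trans (sym (coeff≈ e _)) (above n<m)

  hasDegree⇒≉0 : ∀ {p n} → HasDegree p n → ¬ p ≋ []
  hasDegree⇒≉0 (lead , _) p≈0 = lead (coeff≈ p≈0 _)

  hasDegree-unique : ∀ {p m n} → HasDegree p m → HasDegree p n → m ≡ n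
  hasDegree-unique {p} {m} {n} (lead , above) (lead′ , above′) with ℕ.<-cmp m n
  ... | tri< m<n _ _ = contradiction (above m<n) lead′
  ... | tri≈ _ m≡n _ = m≡n
  ... | tri> _ _ n<m = contradiction (above′ n<m) lead

  hasDegree? : ∀ n p → Dec (HasDegree p n)
  hasDegree? n p with zeroOrDegree p
  ... | inj₁ p≈0 = no λ deg → hasDegree⇒≉0 deg p≈0
  ... | inj₂ (m , deg) = map′ (λ { ≡.refl → deg }) (hasDegree-unique deg) (m ℕ.≟ n)

  degreeBelow : ∀ {p n m} → DegreeBelow p n → HasDegree p m → m < n
  degreeBelow {n = n} {m} below (lead , _) with m ℕ.<? n
  ... | yes m<n = m<n
  ... | no  m≮n = contradiction (below (ℕ.≮⇒≥ m≮n)) lead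

  coeff-∷* : ∀ a p q n → coe ((a ∷ p) A.* q) n ≈ a * coe q n + coe (0# ∷ p A.* q) n
  coeff-∷* a p q n = trans (coeff-+ k (scale k a q) (0# ∷ p A.* q) n) (+-congʳ (coeff-scale k a q n))

  -- Induction on the first factor, read as `a + x p`. In degree 0 the product is `a q`; otherwise
  -- `a q` vanishes above degree `n`, where the coefficients are those of `p q` shifted by one.
  hasDegree-* : ∀ p q {m n} → HasDegree p m → HasDegree q n → HasDegree (p A.* q) (m ℕ.+ n)
  hasDegree-* [] q (lead , _) _ = contradiction refl lead
  hasDegree-* (a ∷ p) q {zero} {n} (lead , above) (lead′ , above′) =
    (λ z → *-≉0 lead lead′ (trans (sym (coeff-a* n)) z)) ,
    λ n<m → trans (coeff-a* _) (trans (*-congˡ (above′ n<m)) (zeroʳ a))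
    where
    p≈0 : p ≋ []
    p≈0 = coeffwise λ i → above (s≤s z≤n)
    shifted : ∀ i → coe (0# ∷ p A.* q) i ≈ 0#
    shifted zero    = refl
    shifted (suc i) = coeff≈ (A.*-congʳ {q} p≈0) i
    coeff-a* : ∀ i → coe ((a ∷ p) A.* q) i ≈ a * coe q i
    coeff-a* i = trans (coeff-∷* a p q i) (trans (+-congˡ (shifted i)) (+-identityʳ _))
  hasDegree-* (a ∷ p) q {suc m} {n} (lead , above) deg@(lead′ , above′)
    with lead″ , above″ ← hasDegree-* p q (lead , above ∘ s≤s) deg =
    (λ z → lead″ (trans (sym (coeff-shift (ℕ.m≤n+m n m))) z)) ,
    λ { {suc i} (s≤s mn<i) → trans (coeff-shift (ℕ.≤-trans (ℕ.m≤n+m n m) (ℕ.<⇒≤ mn<i))) (above″ mn<i) }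
    where
    coeff-shift : ∀ {i} → n ≤ i → coe ((a ∷ p) A.* q) (suc i) ≈ coe (p A.* q) i
    coeff-shift {i} n≤i = trans (coeff-∷* a p q (suc i))
      (trans (+-congʳ (trans (*-congˡ (above′ (s≤s n≤i))) (zeroʳ a))) (+-identityˡ _))

  cancellable : ∀ {p} → ¬ p ≋ [] → Cancellable p
  cancellable {p} p≉0 y z py≈pz with zeroOrDegree (y A.- z)
  ... | inj₁ y-z≈0 = Aᴾ.x∙y⁻¹≈ε⇒x≈y y z y-z≈0
  ... | inj₂ (_ , deg) = contradiction
          (A.trans (Aᴾ.x[y-z]≈xy-xz p y z) (Aᴾ.x≈y⇒x∙y⁻¹≈ε py≈pz))
          (hasDegree⇒≉0 (hasDegree-* p _ (proj₂ (degree p≉0)) deg))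

  -- Induction on coefficients: if `p = s g + t`, then `a + x p = (x s) g + (a + x t)`. The new
  -- remainder has degree at most `n`, and subtracting a scalar multiple of `g` clears its
  -- coefficient at `n`.
  division : ∀ {g n} → HasDegree g n → ∀ p →
             ∃[ s ] ∃[ t ] p ≋ s A.* g A.+ t × DegreeBelow t n
  division deg [] = [] , [] , A.refl , λ _ → refl
  division {g} {n} deg@(lead , above) (a ∷ p)
    with s , t , e , below ← division deg p | u , ul≈1 , _ ← invertible _ lead =
    d ∷ s , (a ∷ t) A.- scale k d g , equality , below′
    where
    -- Here `u` inverts the leading coefficient of `g`, so `d` is the scalar that cancels the
    -- coefficient at `n`.
    d = coe (a ∷ t) n * u
    rearrange : ∀ x y z → (x A.+ y) A.+ (z A.- x) A.≈ y A.+ z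
    rearrange x y z = A.trans (A.+-cong {x A.+ y} (A.+-comm x y) (A.+-comm z (A.- x)))
      (A.trans (A.+-assoc y x _) (A.+-congˡ (A.trans (A.sym (A.+-assoc x (A.- x) z))
        (A.trans (A.+-congʳ (A.-‿inverseʳ x)) (A.+-identityˡ z)))))
    equality : (a ∷ p) ≋ (d ∷ s) A.* g A.+ ((a ∷ t) A.- scale k d g)
    equality = A.trans
      (coeffwise λ { zero → sym (+-identityˡ a) ; (suc i) → coeff≈ e i })
      (A.sym (rearrange (scale k d g) (0# ∷ s A.* g) (a ∷ t)))
    coeff-t : ∀ i → coe ((a ∷ t) A.- scale k d g) i ≈ coe (a ∷ t) i - d * coe g i
    coeff-t i = trans (coeff-+ k (a ∷ t) (A.- scale k d g) i)
      (+-congˡ (trans (coeff-neg k (scale k d g) i) (-‿cong (coeff-scale k d g i))))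
    below-t : ∀ {i} → n < i → coe (a ∷ t) i ≈ 0#
    below-t (s≤s n≤i) = below n≤i
    below′ : DegreeBelow ((a ∷ t) A.- scale k d g) n
    below′ {i} n≤i = trans (coeff-t i) (kᴾ.x≈y⇒x∙y⁻¹≈ε
      ([ (λ n<i → trans (below-t n<i) (sym (trans (*-congˡ (above n<i)) (zeroʳ d))))
       , (λ { ≡.refl → sym (trans (*-assoc _ u _) (trans (*-congˡ ul≈1) (*-identityʳ _))) }) ]′
       (ℕ.m≤n⇒m<n∨m≡n n≤i)))

  -- If `g` divides `p`, the remainder is a multiple of `g`; a nonzero multiple has degree at least
  -- that of `g`, so the remainder must vanish.
  _∣?_ : ∀ {g} → ¬ g ≋ [] → ∀ p → Dec (g ∣ p)
  _∣?_ {g} g≉0 p with n , deg ← degree g≉0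
    with s , t , e , below ← division deg p
    with zeroOrDegree t
  ... | inj₁ t≈0 = yes (s , A.sym (A.trans e (A.trans (A.+-congˡ t≈0) (A.+-identityʳ _))))
  ... | inj₂ (m , deg-t) = no λ (s′ , e′) → ¬multiple (s′ A.- s) (difference s′ e′)
    where
    difference : ∀ s′ → s′ A.* g ≋ p → (s′ A.- s) A.* g ≋ t
    difference s′ e′ = A.trans (Aᴾ.[y-z]x≈yx-zx g s′ s)
      (A.trans (A.+-congʳ (A.trans e′ (A.trans e (A.+-comm _ t))))
        (Aᴾ.//-rightDividesʳ (s A.* g) t))
    ¬multiple : ∀ w → ¬ w A.* g ≋ t
    ¬multiple w wg≈t with zeroOrDegree w
    ... | inj₁ w≈0 = hasDegree⇒≉0 deg-t (A.trans (A.sym wg≈t) (A.*-congʳ {g} w≈0))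
    ... | inj₂ (j , deg-w) = ℕ.<⇒≱ (degreeBelow below deg-t)
      (subst (n ≤_) (hasDegree-unique (hasDegree-resp wg≈t (hasDegree-* w g deg-w deg)) deg-t) (ℕ.m≤n+m n j))

  -- The base `q` digits of `i` name the coefficients, so this enumerates the polynomials of degree
  -- below `n`.
  fromDigits : ∀ n → Fin (q ℕ.^ n) → List Carrier
  fromDigits n i = tabulate λ j → Card.from (finToFun {q} {n} i j)

  coeff-tabulate : ∀ n (f : Fin n → Carrier) p → (∀ j → f j ≈ coe p (toℕ j)) → DegreeBelow p n →
                   tabulate f ≋ p
  coeff-tabulate n f p f≈ below = coeffwise (eq n f p f≈ below)
    where
    coe-tail : ∀ p m → coe (drop 1 p) m ≈ coe p (suc m)
    coe-tail []      m = refl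
    coe-tail (x ∷ p) m = refl
    eq : ∀ n (f : Fin n → Carrier) p → (∀ j → f j ≈ coe p (toℕ j)) → DegreeBelow p n →
         ∀ m → coe (tabulate f) m ≈ coe p m
    eq zero    f p f≈ below m       = sym (below z≤n)
    eq (suc n) f p f≈ below zero    = f≈ Fin.zero
    eq (suc n) f p f≈ below (suc m) = trans
      (eq n (f ∘ Fin.suc) (drop 1 p) (λ j → trans (f≈ (Fin.suc j)) (sym (coe-tail p _)))
        (λ n≤m → trans (coe-tail p _) (below (s≤s n≤m))) m)
      (coe-tail p m)

  digits : ∀ n p → DegreeBelow p n → ∃[ i ] fromDigits n i ≋ p
  digits n p below = i , coeff-tabulate n _ p eq below
    where
    f : Fin n → Fin q
    f j = Card.to (coe p (toℕ j))
    i = funToFin f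
    eq : ∀ j → Card.from (finToFun {q} {n} i j) ≈ coe p (toℕ j)
    eq j = trans (Card.from-cong (Fin.finToFun-funToFin f j)) (Card.strictlyInverseʳ _)

  -- Division by a nonzero member of degree `n` puts a polynomial of degree below `n` in every
  -- class.
  finiteQuotient : ∀ I → IsNonzeroIdeal I → ∃ (Finite (CommutativeRing.setoid (quotientRing (F [x]) I)))
  finiteQuotient I (g , g∈ , g≉0) with n , deg ← degree g≉0 = q ℕ.^ n , record
    { to = fromDigits n
    ; cong = λ { ≡.refl → /.≡-refl I }
    ; surjective = λ p → proj₁ (representative p) , λ { ≡.refl → proj₂ (representative p) }
    }
    where
    representative : ∀ p → ∃[ i ] fromDigits n i ≡ p [mod I ]
    representative p with s , t , e , below ← division deg p with i , eᵢ ← digits n t below =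
      i , /.≡-trans I (/.≈⇒≡ I eᵢ) (/.≡-sym I (congruent
        (Ideal.respects I (A.sym eq) (Ideal.*-closed I s g∈))))
      where
      eq : p A.- t ≋ s A.* g
      eq = A.trans (A.+-congʳ e) (Aᴾ.//-rightDividesʳ t (s A.* g))

  -- A member of least degree divides every other, since a nonzero remainder would be a member of
  -- smaller degree. The least degree is found by testing the finitely many candidates of each
  -- degree for membership.
  principal : ∀ I → U.Decidable (Member I) → IsNonzeroIdeal I → ∃ λ g → Generates g I
  principal I I? (f , f∈ , f≉0) = minimal (least occurs? (f , f∈ , proj₂ (degree f≉0)))
    where
    Occurs : ℕ → Set _
    Occurs n = ∃[ p ] Member I p × HasDegree p n
    occurs? : U.Decidable Occurs
    -- Polynomials of degree `n` have degree below `suc n`, so candidates have `suc n` digits.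
    occurs? n = map′ (λ (i , h) → fromDigits (suc n) i , h) (λ (p , p∈ , deg) →
        let i , e = digits (suc n) p (HasDegree.above≈0 deg)
        in i , Ideal.respects I (A.sym e) p∈ , hasDegree-resp (A.sym e) deg)
      (Fin.any? λ i → I? (fromDigits (suc n) i) ×-dec hasDegree? n (fromDigits (suc n) i))
    minimal : ∃[ n ] Occurs n × (∀ {m} → m < n → ¬ Occurs m) → ∃ λ g → Generates g I
    minimal (n , (g , g∈ , deg) , none) = g , g∈ , divides
      where
      divides : ∀ {p} → Member I p → g ∣ p
      divides {p} p∈ with s , t , e , below ← division deg p with zeroOrDegree t
      ... | inj₁ t≈0 = s , A.sym (A.trans e (A.trans (A.+-congˡ t≈0) (A.+-identityʳ _)))
      ... | inj₂ (m , deg-t) = contradiction (t , t∈ , deg-t) (none (degreeBelow below deg-t))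
        where
        t∈ : Member I t
        t∈ = +-∈⁻ I (Ideal.*-closed I s g∈) (Ideal.respects I e p∈)

  pid : FiniteQuotientPID (F [x])
  pid = record
    { cancellable    = cancellable
    ; _∣?_           = _∣?_
    ; principal      = principal
    ; finiteQuotient = finiteQuotient
    }

  -- The zero ideal

  X : List Carrier
  X = 0# ∷ 1# ∷ []

  hasDegree-X : HasDegree X 1
  hasDegree-X = (λ z → 0≉1 (sym z)) , λ { {suc (suc _)} _ → refl ; {suc zero} (s≤s ()) }

  hasDegree-1 : HasDegree A.1# 0
  hasDegree-1 = (λ z → 0≉1 (sym z)) , λ { {suc _} _ → refl }

  hasDegree-Π : ∀ T → All (_≡ X) T → HasDegree (Π T) (length T)
  hasDegree-Π []      []            = hasDegree-1
  hasDegree-Π (_ ∷ T) (≡.refl ∷ Xs) = hasDegree-* X (Π T) hasDegree-X (hasDegree-Π T Xs)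

  -- Congruence modulo `K` is equality here. A product of `m ≥ 1` copies of `X` has degree `m` and
  -- its square has degree `m + m`, so constant sequences of every finite length avoid idempotents.
  zeroIdeal⇒∞ : ∀ K → IsZeroIdeal K →
    IsErdősBurgessConstant (multiplicativeSemigroup (quotientRing (F [x]) K)) ⊤⁺
  zeroIdeal⇒∞ K zeroK = (λ _ ()) , leastness
    where
    S = /.*-commutativeMonoid K
    avoiding : ∀ n → ¬ HasIdempotent S (replicate n X)
    avoiding n (T , s , 0<len , congruent d) =
      ℕ.<⇒≢ (ℕ.m<m+n (length T) 0<len) (≡.sym
        (hasDegree-unique (hasDegree-resp (Aᴾ.x∙y⁻¹≈ε⇒x≈y _ _ (zeroK d)) (hasDegree-* _ _ deg deg)) deg))
      where
      deg : HasDegree (Π T) (length T)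
      deg = hasDegree-Π T (Sublist.All-resp-⊆ s (All.replicate⁺ n ≡.refl))
    leastness : ∀ m → NoneFreeFrom (multiplicativeSemigroup (quotientRing (F [x]) K)) m → ⊤⁺ ≤⁺ m
    leastness ⊤⁺    _ = _ ≤⊤⁺
    leastness [ m ] h = contradiction (¬hasIdempotent⇒free S (avoiding m))
      (h (replicate m X) [ ℕ.≤-reflexive (≡.sym (length-replicate m)) ])

open import Data.Nat.Base using (_+_)

theorem1p1 :
  {c ℓ : Level} (q : ℕ) → IsPrimePower q →
  (F : FiniteField c ℓ q) (K : Ideal (F [x])) →
  let R  = quotientRing (F [x]) K
      S  = multiplicativeSemigroup R
      U  = units R
  in
  (IsZeroIdeal K → IsErdősBurgessConstant S ⊤⁺)
  ×
  (IsNonzeroIdeal K → (φ : Factorization K) →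
    let open Factorization φ in
    ∃[ I ] ∃[ D ]
      IsErdősBurgessConstant S I × IsDavenportConstant U D ×
      [ D + Ω ∸ ω ] ≤⁺ I ×
      (IsPowerOfPrime ⊎ IsProductOfDistinctPrimes → I ≡ [ D + Ω ∸ ω ]))
theorem1p1 q _ F K =
  zeroIdeal⇒∞ K , λ nonzero φ → ErdősBurgess.constants pid K nonzero φ
  where open Polynomials F
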